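{- Let $q$ be a prime power and let $m+1=(k+1)t$ with integers $k\ge 1$ and $t\ge 3$. Let $\mathbb{S}$ be the collection of sets $S_i$ described in the context. It is possible to construct, using the sets of $\mathbb{S}$ (each subspace being the $\mathbb{GF}(q)$-linear span of the union of $t-1$ sets from $\mathbb{S}$), a set of $(m-k-1)$-dimensional projective subspaces of $\mathbb{P}(m,\mathbb{GF}(q))$ such that no two of these subspaces are contained in a common hyperplane, and such that together they cover all the hyperplanes of $\mathbb{P}(m,\mathbb{GF}(q))$, i.e. every hyperplane contains at least one of the chosen subspaces. They thus create a disjoint partition of the set of hyperplanes.
   Context: $\mathbb{P}(m,\mathbb{GF}(q))$ is the projective space of the $(m+1)$-dimensional $\mathbb{GF}(q)$-vector space $\mathbb{V}=\mathbb{GF}(q^{m+1})$; a $d$-dimensional projective subspace is a $(d+1)$-dimensional vector subspace of $\mathbb{V}$; points are $0$-dimensional and hyperplanes $(m-1)$-dimensional projective subspaces. Let $\alpha$ be a generator of the multiplicative group of $\mathbb{GF}(q^{m+1})$ and $\beta=\frac{q^{m+1}-1}{q^{k+1}-1}$, so that $\{\alpha^{j\beta}\}_{0\le j<q^{k+1}-1}$ is the multiplicative group of the subfield $\mathbb{GF}(q^{k+1})$. Let $\mathbb{S}=\{S_0,\dots,S_{\beta-1}\}$ be its set of cosets, $S_i=\{\alpha^{i+j\beta}:0\le j<q^{k+1}-1\}$. Each $S_i\cup\{0\}$ is a $(k+1)$-dimensional $\mathbb{GF}(q)$-subspace of $\mathbb{V}$, i.e. represents a $k$-dimensional projective subspace,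 and these subspaces partition the points. -}

module Defs where

open import Algebra.Bundles using (CommutativeRing)
open import Algebra.Module.Bundles using (LeftModule)
open import Algebra.Morphism.Structures using (IsRingHomomorphism)
import Algebra.Definitions as AlgebraDefinitions
import Algebra.Properties.CommutativeMonoid.Sum as Sum
import Algebra.Properties.Semiring.Exp as Exp
open import Data.Fin.Base using (Fin; toℕ)
open import Data.Nat.Base as ℕ
  using (ℕ; suc; _^_; _∸_; _<_; NonZero; >-nonZero; nonTrivial⇒n>1)
open import Data.Nat.DivMod using (_/_)
open import Data.Nat.Primality using (Prime; prime⇒nonTrivial)
open import Data.Nat.Properties
  using (≤-trans; m≤m*n; m^n>0; m<n⇒0<n∸m; <⇒≤)
open import Data.Product.Base using (Σ-syntax; ∃₂; ∃-syntax; _×_; _,_)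
open import Data.Vec.Functional using (Vector)
open import Function.Bundles using (Inverse)
open import Level using (_⊔_) renaming (suc to lsuc)
open import Relation.Binary.PropositionalEquality using (_≡_; _≢_; refl)
import Relation.Binary.PropositionalEquality as ≡
open import Relation.Nullary.Negation using (¬_)
open import Relation.Unary using (Pred; _∈_; _⊆_; _≬_; Satisfiable)

PrimePower : ℕ → Set
PrimePower q = ∃₂ λ p e → Prime p × q ≡ p ^ suc e

primePower>1 : ∀ {q} → PrimePower q → 1 < q
primePower>1 (p , e , pr , refl) =
  ≤-trans p>1 (m≤m*n p (p ^ e) {{>-nonZero (m^n>0 p {{>-nonZero (<⇒≤ p>1)}} e)}})
  where
  p>1 : 1 < p
  p>1 = nonTrivial⇒n>1 p {{prime⇒nonTrivial pr}}

qⁿ⁺¹∸1-nonZero : ∀ {q} → PrimePower q → ∀ n → NonZero (q ^ suc n ∸ 1)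
qⁿ⁺¹∸1-nonZero {q} pp n =
  >-nonZero (m<n⇒0<n∸m (≤-trans q>1 (m≤m*n q (q ^ n) {{>-nonZero (m^n>0 q {{>-nonZero (<⇒≤ q>1)}} n)}})))
  where
  q>1 : 1 < q
  q>1 = primePower>1 pp

-- The library's only fields, `Algebra.Apartness.HeytingField`, carry an apartness
-- relation as extra structure; this is the plain definition, without one.
record Field c ℓ : Set (lsuc (c ⊔ ℓ)) where
  field
    commutativeRing : CommutativeRing c ℓ
  open CommutativeRing commutativeRing public
  open AlgebraDefinitions _≈_ using (Invertible)
  field
    1≉0        : ¬ (1# ≈ 0#)
    invertible : ∀ x → ¬ (x ≈ 0#) → Invertible 1# _*_ x
  open Exp semiring public using () renaming (_^_ to infixr 8 _^ᶠ_)

HasOrder : ∀ {c ℓ} → Field c ℓ → ℕ → Set (c ⊔ ℓ)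
HasOrder F n = Inverse (Field.setoid F) (≡.setoid (Fin n))

-- Exponents in ℕ suffice for the fields at hand: the multiplicative group is finite.
IsGenerator : ∀ {c ℓ} (F : Field c ℓ) → Field.Carrier F → Set (c ⊔ ℓ)
IsGenerator F α = ¬ (α ≈ 0#) × (∀ x → ¬ (x ≈ 0#) → ∃[ n ] x ≈ α ^ᶠ n)
  where open Field F

record Extension {c₁ ℓ₁ c₂ ℓ₂} (K : Field c₁ ℓ₁) (L : Field c₂ ℓ₂)
                 : Set (c₁ ⊔ ℓ₁ ⊔ c₂ ⊔ ℓ₂) where
  private
    module K = Field K
    module L = Field L
  field
    embed              : K.Carrier → L.Carrier
    isRingHomomorphism : IsRingHomomorphism K.rawRing L.rawRing embed
  open IsRingHomomorphism isRingHomomorphism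

  vectorSpace : LeftModule K.ring c₂ ℓ₂
  vectorSpace = record
    { Carrierᴹ = L.Carrier
    ; _≈ᴹ_     = L._≈_
    ; _+ᴹ_     = L._+_
    ; _*ₗ_     = λ a x → embed a L.* x
    ; 0ᴹ       = L.0#
    ; -ᴹ_      = L.-_
    ; isLeftModule = record
      { isLeftSemimodule = record
        { +ᴹ-isCommutativeMonoid = L.+-isCommutativeMonoid
        ; isPreleftSemimodule = record
          { *ₗ-cong      = λ a≈b → L.*-cong (⟦⟧-cong a≈b)
          ; *ₗ-zeroˡ     = λ x → L.trans (L.*-congʳ 0#-homo) (L.zeroˡ x)
          ; *ₗ-distribʳ  = λ x a b →
              L.trans (L.*-congʳ (+-homo a b)) (L.distribʳ x (embed a) (embed b))
          ; *ₗ-identityˡ = λ x → L.trans (L.*-congʳ 1#-homo) (L.*-identityˡ x)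
          ; *ₗ-assoc     = λ a b x →
              L.trans (L.*-congʳ (*-homo a b)) (L.*-assoc (embed a) (embed b) x)
          ; *ₗ-zeroʳ     = λ a → L.zeroʳ (embed a)
          ; *ₗ-distribˡ  = λ a x y → L.distribˡ (embed a) x y
          }
        }
      ; -ᴹ‿cong    = L.-‿cong
      ; -ᴹ‿inverse = L.-‿inverse
      }
    }

module Linear {r ℓr v ℓv} (K : Field r ℓr) (V : LeftModule (Field.ring K) v ℓv) where
  open Field K using (0#) renaming (Carrier to Scalar; _≈_ to _≈ˢ_)
  open LeftModule V
  open Sum +ᴹ-commutativeMonoid using (sum)

  record Subspace p : Set (r ⊔ v ⊔ ℓv ⊔ lsuc p) where
    field
      ⟨_⟩       : Pred Carrierᴹ p
      resp-≈    : ∀ {x y} → x ≈ᴹ y → x ∈ ⟨_⟩ → y ∈ ⟨_⟩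
      0∈        : 0ᴹ ∈ ⟨_⟩
      +-closed  : ∀ {x y} → x ∈ ⟨_⟩ → y ∈ ⟨_⟩ → x +ᴹ y ∈ ⟨_⟩
      *ₗ-closed : ∀ a {x} → x ∈ ⟨_⟩ → a *ₗ x ∈ ⟨_⟩

  open Subspace public using (⟨_⟩)

  infix 4 _⊑_
  _⊑_ : ∀ {p p′} → Subspace p → Subspace p′ → Set _
  U ⊑ W = ⟨ U ⟩ ⊆ ⟨ W ⟩

  -- The smallest subspace containing X.
  data InSpan {p} (X : Pred Carrierᴹ p) : Pred Carrierᴹ (r ⊔ v ⊔ ℓv ⊔ p) where
    inject    : ∀ {x} → x ∈ X → InSpan X x
    resp-≈    : ∀ {x y} → x ≈ᴹ y → InSpan X x → InSpan X y
    0∈        : InSpan X 0ᴹ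
    +-closed  : ∀ {x y} → InSpan X x → InSpan X y → InSpan X (x +ᴹ y)
    *ₗ-closed : ∀ a {x} → InSpan X x → InSpan X (a *ₗ x)

  Span : ∀ {p} → Pred Carrierᴹ p → Subspace (r ⊔ v ⊔ ℓv ⊔ p)
  Span X = record
    { ⟨_⟩       = InSpan X
    ; resp-≈    = resp-≈
    ; 0∈        = 0∈
    ; +-closed  = +-closed
    ; *ₗ-closed = *ₗ-closed
    }

  combination : ∀ {d} → Vector Scalar d → Vector Carrierᴹ d → Carrierᴹ
  combination a b = sum (λ i → a i *ₗ b i)

  LinearlyIndependent : ∀ {d} → Vector Carrierᴹ d → Set _
  LinearlyIndependent b = ∀ a → combination a b ≈ᴹ 0ᴹ → ∀ i → a i ≈ˢ 0#

  record IsBasis {p} (W : Subspace p) {d} (b : Vector Carrierᴹ d)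
                 : Set (r ⊔ ℓr ⊔ v ⊔ ℓv ⊔ p) where
    field
      members     : ∀ i → b i ∈ ⟨ W ⟩
      independent : LinearlyIndependent b
      spanning    : ∀ {x} → x ∈ ⟨ W ⟩ → ∃[ a ] x ≈ᴹ combination a b

  HasDimension : ∀ {p} → Subspace p → ℕ → Set _
  HasDimension W d = ∃[ b ] IsBasis W {d} b

  HasProjectiveDimension : ∀ {p} → Subspace p → ℕ → Set _
  HasProjectiveDimension W d = HasDimension W (suc d)

  -- Only meant for V of dimension m + 1, i.e. for projective space of dimension m.
  Hyperplane : ℕ → ∀ p → Set _
  Hyperplane m p = Σ[ H ∈ Subspace p ] HasProjectiveDimension H (m ∸ 1)

β : ∀ {q} → PrimePower q → (k m : ℕ) → ℕ
β {q} pp k m = (q ^ suc m ∸ 1) / (q ^ suc k ∸ 1)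
  where instance _ = qⁿ⁺¹∸1-nonZero pp k

S : ∀ {q} (pp : PrimePower q) (k m : ℕ) {c ℓ} (L : Field c ℓ) → Field.Carrier L →
    Fin (β pp k m) → Pred (Field.Carrier L) ℓ
S {q} pp k m L α i x =
  Σ[ j ∈ Fin (q ^ suc k ∸ 1) ] x ≈ α ^ᶠ (toℕ i ℕ.+ toℕ j ℕ.* β pp k m)
  where open Field L

record IsPartition {i a ℓ} {I : Set i} {A : Set a} (B : I → Pred A ℓ)
                   : Set (i ⊔ a ⊔ ℓ) where
  field
    nonempty : ∀ x → Satisfiable (B x)
    disjoint : ∀ x y → x ≢ y → ¬ (B x ≬ B y)
    covering : ∀ a → ∃[ x ] a ∈ B x

-- Write Q = q^(k+1) and F = {x : x^Q = x}, the subfield of order Q, whose nonzero elements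
-- are the powers of α^β.  For a hyperplane H let core H = {x : F x ⊆ H}, the largest
-- F-subspace in H.  Comparing the sizes of F and of the K-dual of F shows that
-- L = core H ⊕ F v for every v ∉ H, so core H has F-dimension t − 1; scaling an F-basis of
-- core H into the coset representatives α^i exhibits core H as the span of t − 1 cosets.
-- An F-hyperplane contained in H lies in core H, hence equals it.  So the subspaces
-- core H, each listed once, are as required.

module Submission where

open import Defs
open import Algebra.Bundles.Raw using (RawRing)
open import Algebra.Module.Bundles using (LeftModule)
import Algebra.Morphism.RingMonomorphism as RingMonomorphism
open import Algebra.Morphism.Structures using (IsRingHomomorphism; module IsRingHomomorphism)
import Algebra.Properties.AbelianGroup as AbelianGroupProperties
import Algebra.Properties.CommutativeMonoid.Sum as Sum
import Algebra.Properties.CommutativeSemiring.Binomial as Binomial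
import Algebra.Properties.CommutativeSemiring.Exp as Exp
import Algebra.Properties.Group as GroupProperties
import Algebra.Properties.Ring as RingProperties
import Algebra.Properties.Semiring.Mult as Mult
open import Data.Fin.Base as Fin using (Fin; zero; suc; toℕ; fromℕ; fromℕ<; inject₁; punchIn; punchOut;
  finToFun; funToFin)
open import Data.Fin.Permutation using (Permutation; permutation; _⟨$⟩ʳ_)
import Data.Fin.Properties as Fin
open import Data.Nat.Base as ℕ using (ℕ; zero; suc; _!; _∸_; _<_; _≤_; z≤n; s≤s; NonZero)
open import Data.Nat.Combinatorics using (_C_; nCn≡1; nCk≡n!/k![n-k]!; k![n∸k]!∣n!)
open import Data.Nat.Divisibility using (_∣_; divides; m∣m*n; ∣⇒≤; ∣m∣n⇒∣m+n;
  *-cancelˡ-∣; *-cancelʳ-∣; m%n≡0⇒n∣m; _∣0)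
open import Data.Nat.DivMod using (_%_; _/_; m/n*n≡m; m≡m%n+[m/n]*n; m%n<n)
open import Data.Nat.Primality using (Prime; ¬prime[0]; euclidsLemma; prime⇒nonTrivial; prime⇒nonZero)
import Data.Nat.Properties as ℕ
open import Data.Product.Base using (Σ-syntax; ∃; ∃-syntax; _×_; _,_; proj₁; proj₂)
open import Data.Sum.Base using (inj₁; inj₂)
open import Data.Unit.Base using (tt)
open import Data.Vec.Functional using (Vector; _∷_; removeAt; replicate)
open import Function.Base using (_∘_; _on_)
open import Function.Bundles using (Inverse)
open import Function.Definitions using (Injective)
open import Level using (Level; _⊔_)
open import Relation.Binary.Bundles using (Setoid)
open import Relation.Binary.Definitions using (Decidable; Symmetric; _Respects_; tri<; tri≈; tri>)
open import Relation.Binary.PropositionalEquality as ≡ using (_≡_; _≢_; cong; subst)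
import Relation.Binary.Reasoning.Setoid as ≈-Reasoning
open import Relation.Nullary.Decidable using (Dec; yes; no; map′; ¬?; _×-dec_; _→-dec_; decidable-stable)
open import Relation.Nullary.Negation using (¬_; contradiction)
open import Relation.Unary using (Pred; _⊆_; ⋃; U)

-- Why the K-dual of F settles the matter: let f be the K-functional with kernel H and f(v) = 1.
-- Every y in L gives a K-functional c ↦ f(c y) on F. Those given by y = x v with x in F are
-- pairwise distinct, since a nonzero x has its inverse in F and f(x⁻¹ x v) = 1. As F and its K-dual
-- are equally large, these are all the functionals, so every y shares its functional with some x v,
-- and that says F (y - x v) ⊆ H.
--
-- Two features shape the rest. Subspaces are compared by counting instead of by exchange arguments:
-- a dimension is the exponent in the number of elements, and an inclusion between sets of equal
-- size is an equality. And hyperplanes are arbitrary predicates, which cannot be listed, so the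
-- cores are collected by a finite search through the tuples of field elements that may serve as
-- bases.

private variable
  c ℓ p p′ : Level

-- Prime divisors of binomial coefficients.

prime∣n!⇒≤ : ∀ {r} → Prime r → ∀ n → r ∣ n ! → r ≤ n
prime∣n!⇒≤ {r} r-prime zero r∣1 =
  contradiction (∣⇒≤ r∣1) (ℕ.<⇒≱ (ℕ.nonTrivial⇒n>1 r {{prime⇒nonTrivial r-prime}}))
prime∣n!⇒≤ r-prime (suc n) r∣ with euclidsLemma (suc n) (n !) r-prime r∣
... | inj₁ r∣1+n = ∣⇒≤ r∣1+n
... | inj₂ r∣n! = ℕ.m≤n⇒m≤1+n (prime∣n!⇒≤ r-prime n r∣n!)

-- r divides r! = (r C k) k! (r - k)!, but not the factorial of a number below r. This kills the
-- inner terms of the binomial expansion in `frobenius`.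
prime∣pCk : ∀ {r k} → Prime r → 0 < k → k < r → r ∣ r C k
prime∣pCk {r} {k} r-prime 0<k k<r with
  euclidsLemma (r C k) (k ! ℕ.* (r ∸ k) !) r-prime (subst (r ∣_) (≡.sym rCk*k![r∸k]!≡r!) (r∣r! r))
  where
  instance _ = k ℕ.!* (r ∸ k) !≢0
  rCk*k![r∸k]!≡r! : (r C k) ℕ.* (k ! ℕ.* (r ∸ k) !) ≡ r !
  rCk*k![r∸k]!≡r! = ≡.trans (cong (ℕ._* (k ! ℕ.* (r ∸ k) !)) (nCk≡n!/k![n-k]! (ℕ.<⇒≤ k<r)))
                            (m/n*n≡m (k![n∸k]!∣n! (ℕ.<⇒≤ k<r)))
  r∣r! : ∀ n → .{{NonZero n}} → n ∣ n !
  r∣r! (suc n) = m∣m*n (n !)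
  instance _ = prime⇒nonZero r-prime
... | inj₁ r∣rCk = r∣rCk
... | inj₂ r∣ with euclidsLemma (k !) ((r ∸ k) !) r-prime r∣
...   | inj₁ r∣k! = contradiction (prime∣n!⇒≤ r-prime k r∣k!) (ℕ.<⇒≱ k<r)
...   | inj₂ r∣[r∸k]! =
  contradiction (prime∣n!⇒≤ r-prime (r ∸ k) r∣[r∸k]!) (ℕ.<⇒≱ (ℕ.∸-monoʳ-< 0<k (ℕ.<⇒≤ k<r)))

-- Counting by bijections with `Fin n`.

injective⇒onto : ∀ {n} {f : Fin n → Fin n} → Injective _≡_ _≡_ f → ∀ j → ∃[ i ] f i ≡ j
injective⇒onto {suc n} {f} f-injective j with Fin.any? (λ i → f i Fin.≟ j)
... | yes hit = hit
-- Deleting the missed value j would inject `Fin (suc n)` into `Fin n`.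
... | no miss = contradiction
  (Fin.injective⇒≤ {f = λ i → punchOut (j≢f i)}
    (λ {i} {i′} eq → f-injective (Fin.punchOut-injective (j≢f i) (j≢f i′) eq)))
  ℕ.1+n≰n
  where
  j≢f : ∀ i → j ≢ f i
  j≢f i j≡fi = miss (i , ≡.sym j≡fi)

-- P has n elements up to `_≈_`. Since `index` takes a membership proof, P may be undecidable, as an
-- arbitrary subspace is at first.
record Enumeration (A : Setoid c ℓ) (P : Pred (Setoid.Carrier A) p) (n : ℕ)
                   : Set (c ⊔ ℓ ⊔ p) where
  open Setoid A
  field
    enum       : Fin n → Carrier
    member     : ∀ i → P (enum i)
    injective  : ∀ {i j} → enum i ≈ enum j → i ≡ j
    index      : ∀ {x} → P x → Fin n
    enum-index : ∀ {x} (x∈P : P x) → enum (index x∈P) ≈ x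

module _ {A : Setoid c ℓ} {P : Pred (Setoid.Carrier A) p} {Q : Pred (Setoid.Carrier A) p′} where
  open Setoid A renaming (refl to ≈-refl; sym to ≈-sym; trans to ≈-trans)

  module _ {m n} (e : Enumeration A P m) (f : Enumeration A Q n) (P⊆Q : P ⊆ Q) where
    private
      module e = Enumeration e
      module f = Enumeration f

      reindex : Fin m → Fin n
      reindex i = f.index (P⊆Q (e.member i))

      enum-reindex : ∀ i → f.enum (reindex i) ≈ e.enum i
      enum-reindex i = f.enum-index (P⊆Q (e.member i))

    reindex-injective : Injective _≡_ _≡_ reindex
    reindex-injective {i} {j} eq = e.injective (≈-trans (≈-sym (enum-reindex i))
      (≈-trans (reflexive (cong f.enum eq)) (enum-reindex j)))

    ⊆⇒≤ : m ≤ n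
    ⊆⇒≤ = Fin.injective⇒≤ reindex-injective

  -- The inclusion induces an injective map of `Fin n` to itself, which is onto, so each element of
  -- Q is one of the enumerated elements of P.
  ⊆∧≡⇒⊇ : ∀ {n} → P Respects _≈_ → Enumeration A P n → Enumeration A Q n → P ⊆ Q → Q ⊆ P
  ⊆∧≡⇒⊇ P-resp e f P⊆Q x∈Q with injective⇒onto (reindex-injective e f P⊆Q) (Enumeration.index f x∈Q)
  ... | i , eq = P-resp
    (≈-trans (≈-sym (enum-index (P⊆Q (Enumeration.member e i))))
             (≈-trans (reflexive (cong enum eq)) (enum-index x∈Q)))
    (Enumeration.member e i)
    where open Enumeration f using (enum; enum-index)

module _ {A : Setoid c ℓ} {P : Pred (Setoid.Carrier A) p} {m n}
         (e : Enumeration A P m) (f : Enumeration A P n) where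
  size-unique : m ≡ n
  size-unique = ℕ.≤-antisym (⊆⇒≤ e f (λ x∈P → x∈P)) (⊆⇒≤ f e (λ x∈P → x∈P))

module Finite {A : Setoid c ℓ} {n} (A↔Fin : Inverse A (≡.setoid (Fin n))) where
  open Setoid A renaming (refl to ≈-refl; sym to ≈-sym; trans to ≈-trans)
  open Inverse A↔Fin using (to; from; to-cong; strictlyInverseˡ; strictlyInverseʳ)

  infix 4 _≈?_
  _≈?_ : Decidable _≈_
  x ≈? y = map′
    (λ eq → ≈-trans (≈-sym (strictlyInverseʳ x)) (≈-trans (reflexive (cong from eq)) (strictlyInverseʳ y)))
    to-cong (to x Fin.≟ to y)

  any? : {P : Pred Carrier p} → P Respects _≈_ → (∀ x → Dec (P x)) → Dec (∃ P)
  any? resp P? = map′ (λ (i , p) → from i , p)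
    (λ (x , p) → to x , resp (≈-sym (strictlyInverseʳ x)) p) (Fin.any? (P? ∘ from))

  all? : {P : Pred Carrier p} → P Respects _≈_ → (∀ x → Dec (P x)) → Dec (∀ x → P x)
  all? resp P? = map′ (λ f x → resp (strictlyInverseʳ x) (f (to x)))
    (λ f i → f (from i)) (Fin.all? (P? ∘ from))

  enumeration : Enumeration A (U {A = Carrier}) n
  enumeration = record
    { enum = from ; member = λ _ → tt
    ; injective = λ {i} {j} eq →
        ≡.trans (≡.sym (strictlyInverseˡ i)) (≡.trans (to-cong eq) (strictlyInverseˡ j))
    ; index = λ {x} _ → to x
    ; enum-index = λ {x} _ → strictlyInverseʳ x }

-- Finite fields: characteristic, Frobenius map and Fermat's identity.

AdditivePower : Field c ℓ → ℕ → Set (c ⊔ ℓ)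
AdditivePower F i = ∀ x y → (x + y) ^ᶠ i ≈ x ^ᶠ i + y ^ᶠ i
  where open Field F

FixedBy : (F : Field c ℓ) → ℕ → Pred (Field.Carrier F) ℓ
FixedBy F i x = x ^ᶠ i ≈ x
  where open Field F

module FieldProperties (F : Field c ℓ) where
  open Field F hiding (zero)
  open ≈-Reasoning setoid
  open Exp commutativeSemiring public using (^-congˡ; ^-congʳ; ^-homo-*; ^-assocʳ; ^-distrib-*)
  open Mult semiring using (×-congʳ; ×-assocˡ; ×-assoc-*) renaming (_×_ to _∙_)

  inverse : ∀ {x} → ¬ (x ≈ 0#) → Carrier
  inverse {x} x≉0 = proj₁ (invertible x x≉0)

  inverseˡ : ∀ {x} (x≉0 : ¬ (x ≈ 0#)) → inverse x≉0 * x ≈ 1#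
  inverseˡ {x} x≉0 = proj₁ (proj₂ (invertible x x≉0))

  inverse*[x*y]≈y : ∀ {x} (x≉0 : ¬ (x ≈ 0#)) y → inverse x≉0 * (x * y) ≈ y
  inverse*[x*y]≈y {x} x≉0 y = begin
    inverse x≉0 * (x * y) ≈⟨ *-assoc _ _ _ ⟨
    inverse x≉0 * x * y   ≈⟨ *-congʳ (inverseˡ x≉0) ⟩
    1# * y                ≈⟨ *-identityˡ y ⟩
    y                     ∎

  x*[inverse*y]≈y : ∀ {x} (x≉0 : ¬ (x ≈ 0#)) y → x * (inverse x≉0 * y) ≈ y
  x*[inverse*y]≈y {x} x≉0 y = begin
    x * (inverse x≉0 * y) ≈⟨ *-assoc _ _ _ ⟨
    x * inverse x≉0 * y   ≈⟨ *-congʳ (*-comm _ _) ⟩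
    inverse x≉0 * x * y   ≈⟨ *-congʳ (inverseˡ x≉0) ⟩
    1# * y                ≈⟨ *-identityˡ y ⟩
    y                     ∎

  *-cancelˡ-nonZero : ∀ {x y z} → ¬ (x ≈ 0#) → x * y ≈ x * z → y ≈ z
  *-cancelˡ-nonZero {x} {y} {z} x≉0 eq = begin
    y                     ≈⟨ inverse*[x*y]≈y x≉0 y ⟨
    inverse x≉0 * (x * y) ≈⟨ *-congˡ eq ⟩
    inverse x≉0 * (x * z) ≈⟨ inverse*[x*y]≈y x≉0 z ⟩
    z                     ∎

  x*y≈0⇒y≈0 : ∀ {x y} → ¬ (x ≈ 0#) → x * y ≈ 0# → y ≈ 0#
  x*y≈0⇒y≈0 {x} x≉0 eq = *-cancelˡ-nonZero x≉0 (trans eq (sym (zeroʳ x)))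

  x^n≉0 : ∀ {x} → ¬ (x ≈ 0#) → ∀ n → ¬ (x ^ᶠ n ≈ 0#)
  x^n≉0 x≉0 zero    = 1≉0
  x^n≉0 x≉0 (suc n) = x^n≉0 x≉0 n ∘ x*y≈0⇒y≈0 x≉0

  0^n≈0 : ∀ n → .{{NonZero n}} → 0# ^ᶠ n ≈ 0#
  0^n≈0 (suc n) = zeroˡ (0# ^ᶠ n)

  1^n≈1 : ∀ n → 1# ^ᶠ n ≈ 1#
  1^n≈1 zero    = refl
  1^n≈1 (suc n) = trans (*-identityˡ _) (1^n≈1 n)

  -- Only the two outer terms of the binomial expansion survive: the inner coefficients are
  -- multiples of r, which is zero in F.
  frobenius : ∀ {r} → Prime r → r ∙ 1# ≈ 0# → AdditivePower F r
  frobenius {zero} r-prime _ = contradiction r-prime ¬prime[0]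
  frobenius {r@(suc r-1)} r-prime r1≈0 x y = begin
    (x + y) ^ᶠ r                                   ≈⟨ theorem r x y ⟩
    term zero + sum (term ∘ suc)                   ≈⟨ +-cong first (sum-init-last (term ∘ suc)) ⟩
    y ^ᶠ r + (sum (term ∘ suc ∘ inject₁) + term (suc (fromℕ r-1)))
                                                   ≈⟨ +-congˡ (+-cong middle final) ⟩
    y ^ᶠ r + (0# + x ^ᶠ r)                         ≈⟨ +-congˡ (+-identityˡ _) ⟩
    y ^ᶠ r + x ^ᶠ r                                ≈⟨ +-comm _ _ ⟩
    x ^ᶠ r + y ^ᶠ r                                ∎
    where
    open Binomial commutativeSemiring using (theorem; binomialTerm)
    open Sum +-commutativeMonoid using (sum; sum-init-last; sum-cong-≋; sum-replicate-zero)
    term : Vector Carrier (suc r)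
    term = binomialTerm x y r
    first : term zero ≈ y ^ᶠ r
    first = trans (+-identityʳ _) (*-identityˡ _)
    multiple≈0 : ∀ {n} z → r ∣ n → n ∙ z ≈ 0#
    multiple≈0 z (divides d ≡.refl) = begin
      (d ℕ.* r) ∙ z        ≈⟨ ×-assocˡ z d r ⟨
      d ∙ (r ∙ z)          ≈⟨ ×-congʳ d (×-congʳ r (*-identityˡ z)) ⟨
      d ∙ (r ∙ (1# * z))   ≈⟨ ×-congʳ d (×-assoc-* r 1# z) ⟨
      d ∙ (r ∙ 1# * z)     ≈⟨ ×-congʳ d (trans (*-congʳ r1≈0) (zeroˡ z)) ⟩
      d ∙ 0#               ≈⟨ ×-congʳ d (zeroˡ 0#) ⟨
      d ∙ (0# * 0#)        ≈⟨ ×-assoc-* d 0# 0# ⟨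
      d ∙ 0# * 0#          ≈⟨ zeroʳ _ ⟩
      0#                   ∎
    middle : sum (term ∘ suc ∘ inject₁) ≈ 0#
    middle = trans
      (sum-cong-≋ (λ i → multiple≈0 _ (prime∣pCk r-prime (s≤s z≤n)
        (s≤s (subst (ℕ._≤ r-1) (≡.cong suc (≡.sym (Fin.toℕ-inject₁ i))) (Fin.toℕ<n i))))))
      (sum-replicate-zero r-1)
    final : term (suc (fromℕ r-1)) ≈ x ^ᶠ r
    final rewrite Fin.toℕ-fromℕ r-1 | nCn≡1 r | ℕ.n∸n≡0 r-1 =
      trans (+-identityʳ _) (*-identityʳ _)

  frobenius-iterated : ∀ {r} → Prime r → r ∙ 1# ≈ 0# → ∀ n → AdditivePower F (r ℕ.^ n)
  frobenius-iterated r-prime r1≈0 zero x y =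
    trans (*-identityʳ _) (sym (+-cong (*-identityʳ x) (*-identityʳ y)))
  frobenius-iterated {r} r-prime r1≈0 (suc n) x y = begin
    (x + y) ^ᶠ (r ℕ.* r ℕ.^ n)                          ≈⟨ ^-assocʳ (x + y) r (r ℕ.^ n) ⟨
    ((x + y) ^ᶠ r) ^ᶠ (r ℕ.^ n)                         ≈⟨ ^-congˡ (r ℕ.^ n) (frobenius r-prime r1≈0 x y) ⟩
    (x ^ᶠ r + y ^ᶠ r) ^ᶠ (r ℕ.^ n)                      ≈⟨ frobenius-iterated r-prime r1≈0 n _ _ ⟩
    (x ^ᶠ r) ^ᶠ (r ℕ.^ n) + (y ^ᶠ r) ^ᶠ (r ℕ.^ n)       ≈⟨ +-cong (^-assocʳ x r (r ℕ.^ n)) (^-assocʳ y r (r ℕ.^ n)) ⟩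
    x ^ᶠ (r ℕ.* r ℕ.^ n) + y ^ᶠ (r ℕ.* r ℕ.^ n)         ∎

module FiniteField (F : Field c ℓ) {n} (order : HasOrder F n) where
  open Field F hiding (zero)
  open FieldProperties F
  open ≈-Reasoning setoid
  open Mult semiring using (×1-homo-*) renaming (_×_ to _∙_)
  open Finite order public
  open Inverse order public using (to; from; to-cong; strictlyInverseˡ; strictlyInverseʳ)

  order-nonZero : NonZero n
  order-nonZero = Fin.nonZeroIndex (to 0#)

  1<order : 1 < n
  1<order = ℕ.≤∧≢⇒< (ℕ.>-nonZero⁻¹ n {{order-nonZero}}) (λ 1≡n → 1≉0 (begin
    1#           ≈⟨ strictlyInverseʳ 1# ⟨
    from (to 1#) ≡⟨ cong from (collapse 1≡n (to 1#) (to 0#)) ⟩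
    from (to 0#) ≈⟨ strictlyInverseʳ 0# ⟩
    0#           ∎))
    where
    collapse : ∀ {k} → 1 ≡ k → ∀ (i j : Fin k) → i ≡ j
    collapse ≡.refl zero zero = ≡.refl

  private
    reindexing : (f g : Carrier → Carrier) → (∀ {x y} → x ≈ y → f x ≈ f y) →
                 (∀ {x y} → x ≈ y → g x ≈ g y) →
                 (∀ x → f (g x) ≈ x) → (∀ x → g (f x) ≈ x) → Permutation n n
    reindexing f g f-cong g-cong fg≈id gf≈id = permutation (to ∘ f ∘ from) (to ∘ g ∘ from)
      (λ i → ≡.trans (to-cong (trans (f-cong (strictlyInverseʳ _)) (fg≈id _))) (strictlyInverseˡ i))
      (λ i → ≡.trans (to-cong (trans (g-cong (strictlyInverseʳ _)) (gf≈id _))) (strictlyInverseˡ i))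

  -- Adding `1#` permutes the elements, so the sum of all elements does not change when n copies of
  -- `1#` are added to it.
  order∙1≈0 : n ∙ 1# ≈ 0#
  order∙1≈0 = +-cancelˡ (sum from) _ _ (begin
    sum from + n ∙ 1#               ≈⟨ +-congˡ (sum-replicate n) ⟨
    sum from + sum (replicate n 1#) ≈⟨ ∑-distrib-+ from _ ⟨
    sum (λ i → from i + 1#)         ≈⟨ sum-cong-≋ (λ i → strictlyInverseʳ (from i + 1#)) ⟨
    sum (λ i → from (π ⟨$⟩ʳ i))     ≈⟨ sum-permute from π ⟨
    sum from                        ≈⟨ +-identityʳ _ ⟨
    sum from + 0#                   ∎)
    where
    open Sum +-commutativeMonoid
    open GroupProperties +-group using () renaming (∙-cancelˡ to +-cancelˡ)
    π : Permutation n n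
    π = reindexing (_+ 1#) (_+ - 1#) +-congʳ +-congʳ
      (λ x → trans (+-assoc x _ _) (trans (+-congˡ (-‿inverseˡ 1#)) (+-identityʳ x)))
      (λ x → trans (+-assoc x _ _) (trans (+-congˡ (-‿inverseʳ 1#)) (+-identityʳ x)))

  -- In the product of all elements 0 is replaced by 1, so that multiplying the
  -- elements by a ≠ 0 contributes the factor a except at 0.
  x^order≈x : ∀ a → a ^ᶠ n ≈ a
  x^order≈x a with a ≈? 0#
  ... | yes a≈0 = trans (^-congˡ n a≈0) (trans (0^n≈0 n {{order-nonZero}}) (sym a≈0))
  ... | no a≉0 = cases n ≡.refl
    where
    open Sum *-commutativeMonoid using ()
      renaming (sum to product; sum-cong-≋ to product-cong; sum-permute to product-permute;
                ∑-distrib-+ to ∏-distrib-*; sum-remove to product-remove; sum-replicate to product-replicate)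
    if≈0 : Carrier → Carrier → Carrier → Carrier
    if≈0 x y z with x ≈? 0#
    ... | yes _ = y
    ... | no _ = z
    nonZeroed factor : Fin n → Carrier
    nonZeroed i = if≈0 (from i) 1# (from i)
    factor i = if≈0 (from i) 1# a
    π : Permutation n n
    π = reindexing (a *_) (inverse a≉0 *_) *-congˡ *-congˡ (x*[inverse*y]≈y a≉0) (inverse*[x*y]≈y a≉0)
    scaled : ∀ i → nonZeroed (π ⟨$⟩ʳ i) ≈ factor i * nonZeroed i
    scaled i with from i ≈? 0# | from (to (a * from i)) ≈? 0#
    ... | yes x≈0 | yes ax≈0 = sym (*-identityˡ 1#)
    ... | yes x≈0 | no ax≉0 = contradiction
      (trans (strictlyInverseʳ _) (trans (*-congˡ x≈0) (zeroʳ a))) ax≉0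
    ... | no x≉0 | yes ax≈0 = contradiction
      (x*y≈0⇒y≈0 a≉0 (trans (sym (strictlyInverseʳ _)) ax≈0)) x≉0
    ... | no x≉0 | no ax≉0 = strictlyInverseʳ _
    nonZeroed≉0 : ∀ i → ¬ (nonZeroed i ≈ 0#)
    nonZeroed≉0 i eq with from i ≈? 0#
    ... | yes _ = 1≉0 eq
    ... | no x≉0 = x≉0 eq
    product≉0 : ∀ {m} (f : Fin m → Carrier) → (∀ i → ¬ (f i ≈ 0#)) → ¬ (product f ≈ 0#)
    product≉0 {zero} f f≉0 = 1≉0
    product≉0 {suc m} f f≉0 = product≉0 (f ∘ suc) (f≉0 ∘ suc) ∘ x*y≈0⇒y≈0 (f≉0 zero)
    product-factor≈1 : product factor ≈ 1#
    product-factor≈1 = *-cancelˡ-nonZero (product≉0 nonZeroed nonZeroed≉0) (begin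
      product nonZeroed * product factor            ≈⟨ *-comm _ _ ⟩
      product factor * product nonZeroed            ≈⟨ ∏-distrib-* factor nonZeroed ⟨
      product (λ i → factor i * nonZeroed i)        ≈⟨ product-cong scaled ⟨
      product (λ i → nonZeroed (π ⟨$⟩ʳ i))          ≈⟨ product-permute nonZeroed π ⟨
      product nonZeroed                             ≈⟨ *-identityʳ _ ⟨
      product nonZeroed * 1#                        ∎)
    -- With n a successor, the factor at the index of `0#` can be split off; the m remaining factors
    -- all equal a.
    cases : ∀ m → m ≡ n → a ^ᶠ n ≈ a
    cases zero ≡.refl = contradiction (to 0#) Fin.¬Fin0
    cases (suc m) ≡.refl = begin
      a * a ^ᶠ m                                    ≈⟨ *-congˡ (product-replicate m) ⟨
      a * product (replicate m a)                   ≈⟨ *-congˡ (product-cong off-zero) ⟨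
      a * product (removeAt factor (to 0#))         ≈⟨ *-congˡ (*-identityˡ _) ⟨
      a * (1# * product (removeAt factor (to 0#)))  ≈⟨ *-congˡ (*-congʳ at-zero) ⟨
      a * (factor (to 0#) * product (removeAt factor (to 0#))) ≈⟨ *-congˡ (product-remove factor) ⟨
      a * product factor                            ≈⟨ *-congˡ product-factor≈1 ⟩
      a * 1#                                        ≈⟨ *-identityʳ a ⟩
      a                                             ∎
      where
      at-zero : factor (to 0#) ≈ 1#
      at-zero with from (to 0#) ≈? 0#
      ... | yes _ = refl
      ... | no ≉0 = contradiction (strictlyInverseʳ 0#) ≉0
      off-zero : ∀ i → removeAt factor (to 0#) i ≈ a
      off-zero i with from (punchIn (to 0#) i) ≈? 0#
      ... | no _ = refl
      ... | yes eq = contradiction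
        (≡.trans (≡.sym (strictlyInverseˡ _)) (to-cong eq)) (Fin.punchInᵢ≢i (to 0#) i)

  -- The multiple is the m-th power of `r ∙ 1#`, and a field has no zero divisors. This recovers the
  -- characteristic from the order.
  [r^m]∙1≈0⇒r∙1≈0 : ∀ r m → (r ℕ.^ m) ∙ 1# ≈ 0# → r ∙ 1# ≈ 0#
  [r^m]∙1≈0⇒r∙1≈0 r zero eq = contradiction (trans (sym (+-identityʳ 1#)) eq) 1≉0
  [r^m]∙1≈0⇒r∙1≈0 r (suc m) eq with r ∙ 1# ≈? 0#
  ... | yes r1≈0 = r1≈0
  ... | no r1≉0 = [r^m]∙1≈0⇒r∙1≈0 r m (x*y≈0⇒y≈0 r1≉0 (trans (sym (×1-homo-* r (r ℕ.^ m))) eq))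

-- Linear algebra over a finite field by counting.

d<q^d : ∀ {q} → 1 < q → ∀ d → d < q ℕ.^ d
d<q^d q>1 zero = s≤s z≤n
d<q^d {q} q>1 (suc d) = ℕ.≤-<-trans (d<q^d q>1 d) (ℕ.^-monoʳ-< q q>1 (ℕ.n<1+n d))

funToFin-cong : ∀ {m n} {f g : Fin m → Fin n} → (∀ i → f i ≡ g i) → funToFin f ≡ funToFin g
funToFin-cong {zero} f≗g = ≡.refl
funToFin-cong {suc m} f≗g = ≡.cong₂ Fin.combine (f≗g zero) (funToFin-cong (f≗g ∘ suc))

module FiniteSpace {r ℓr v ℓv} (K : Field r ℓr) {q} (|K|≡q : HasOrder K q)
                   (V : LeftModule (Field.ring K) v ℓv) {n}
                   (|V|≡n : Inverse (LeftModule.≈ᴹ-setoid V) (≡.setoid (Fin n))) where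
  open Field K using (_≈_; _+_; _*_; -_; 0#; 1#)
  private
    module K = Field K
    module |K| = FiniteField K |K|≡q
    module |V| = Finite |V|≡n
  open FieldProperties K
  open LeftModule V
  open Linear K V
  open Sum +ᴹ-commutativeMonoid using (sum; sum-cong-≋; ∑-distrib-+)
  open ≈-Reasoning ≈ᴹ-setoid

  module _ {d} (b : Vector Carrierᴹ d) where
    combination-cong : ∀ {a a′} → (∀ i → a i ≈ a′ i) → combination a b ≈ᴹ combination a′ b
    combination-cong a≈a′ = sum-cong-≋ (λ i → *ₗ-cong (a≈a′ i) ≈ᴹ-refl)

    combination-+ : ∀ a a′ → combination (λ i → a i + a′ i) b ≈ᴹ combination a b +ᴹ combination a′ b
    combination-+ a a′ = ≈ᴹ-trans
      (sum-cong-≋ (λ i → *ₗ-distribʳ (b i) (a i) (a′ i)))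
      (∑-distrib-+ (λ i → a i *ₗ b i) (λ i → a′ i *ₗ b i))

  linearlyIndependent-resp : ∀ {d} {b b′ : Vector Carrierᴹ d} → (∀ i → b i ≈ᴹ b′ i) →
                             LinearlyIndependent b → LinearlyIndependent b′
  linearlyIndependent-resp b≈b′ independent a eq =
    independent a (≈ᴹ-trans (sum-cong-≋ (λ i → *ₗ-cong K.refl (b≈b′ i))) eq)

  combination-* : ∀ {d} (b : Vector Carrierᴹ d) s a →
                  combination (λ i → s * a i) b ≈ᴹ s *ₗ combination a b
  combination-* {zero} b s a = ≈ᴹ-sym (*ₗ-zeroʳ s)
  combination-* {suc d} b s a = ≈ᴹ-trans
    (+ᴹ-cong (*ₗ-assoc s (a zero) (b zero)) (combination-* (b ∘ suc) s (a ∘ suc)))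
    (≈ᴹ-sym (*ₗ-distribˡ s _ _))

  combination-0 : ∀ {d} (b : Vector Carrierᴹ d) → combination (λ _ → 0#) b ≈ᴹ 0ᴹ
  combination-0 {zero} b = ≈ᴹ-refl
  combination-0 {suc d} b =
    ≈ᴹ-trans (+ᴹ-cong (*ₗ-zeroˡ (b zero)) (combination-0 (b ∘ suc))) (+ᴹ-identityˡ 0ᴹ)

  combination-closed : ∀ (W : Subspace p) {d} {b : Vector Carrierᴹ d} →
                       (∀ i → ⟨ W ⟩ (b i)) → ∀ a → ⟨ W ⟩ (combination a b)
  combination-closed W {zero} b∈W a = Subspace.0∈ W
  combination-closed W {suc d} b∈W a = Subspace.+-closed W
    (Subspace.*ₗ-closed W (a zero) (b∈W zero)) (combination-closed W (b∈W ∘ suc) (a ∘ suc))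

  -ᴹx≈-1x : ∀ x → -ᴹ x ≈ᴹ (- 1#) *ₗ x
  -ᴹx≈-1x x = ≈ᴹ-sym (inverseˡ-unique _ _ (begin
    (- 1#) *ₗ x +ᴹ x         ≈⟨ +ᴹ-congˡ (*ₗ-identityˡ x) ⟨
    (- 1#) *ₗ x +ᴹ 1# *ₗ x   ≈⟨ *ₗ-distribʳ x (- 1#) 1# ⟨
    (- 1# + 1#) *ₗ x         ≈⟨ *ₗ-cong (K.-‿inverseˡ 1#) ≈ᴹ-refl ⟩
    0# *ₗ x                  ≈⟨ *ₗ-zeroˡ x ⟩
    0ᴹ                       ∎))
    where open GroupProperties +ᴹ-group

  difference-closed : ∀ (W : Subspace p) {x y} → ⟨ W ⟩ x → ⟨ W ⟩ y → ⟨ W ⟩ (x +ᴹ -ᴹ y)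
  difference-closed W x∈W y∈W = Subspace.+-closed W x∈W
    (Subspace.resp-≈ W (≈ᴹ-sym (-ᴹx≈-1x _)) (Subspace.*ₗ-closed W (- 1#) y∈W))

  IsCombination : ∀ {d} → Vector Carrierᴹ d → Pred Carrierᴹ _
  IsCombination b x = ∃[ a ] x ≈ᴹ combination a b

  Combinations : ∀ {d} → Vector Carrierᴹ d → Subspace _
  Combinations b = record
    { ⟨_⟩ = IsCombination b
    ; resp-≈ = λ x≈y (a , eq) → a , ≈ᴹ-trans (≈ᴹ-sym x≈y) eq
    ; 0∈ = (λ _ → 0#) , ≈ᴹ-sym (combination-0 b)
    ; +-closed = λ (a , x≈) (a′ , y≈) →
        (λ i → a i + a′ i) , ≈ᴹ-trans (+ᴹ-cong x≈ y≈) (≈ᴹ-sym (combination-+ b a a′))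
    ; *ₗ-closed = λ s (a , x≈) →
        (λ i → s * a i) , ≈ᴹ-trans (*ₗ-cong K.refl x≈) (≈ᴹ-sym (combination-* b s a))
    }

  δ : ∀ {d} → Fin d → Vector K.Carrier d
  δ zero    = 1# ∷ λ _ → 0#
  δ (suc i) = 0# ∷ δ i

  combination-δ : ∀ {d} (b : Vector Carrierᴹ d) i → combination (δ i) b ≈ᴹ b i
  combination-δ b zero = ≈ᴹ-trans
    (+ᴹ-cong (*ₗ-identityˡ (b zero)) (combination-0 (b ∘ suc))) (+ᴹ-identityʳ _)
  combination-δ b (suc i) = ≈ᴹ-trans
    (+ᴹ-cong (*ₗ-zeroˡ (b zero)) (combination-δ (b ∘ suc) i)) (+ᴹ-identityˡ _)

  δ-diagonal : ∀ {d} (i : Fin d) → δ i i ≈ 1#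
  δ-diagonal zero = K.refl
  δ-diagonal (suc i) = δ-diagonal i

  δ-off-diagonal : ∀ {d} {i j : Fin d} → i ≢ j → δ i j ≈ 0#
  δ-off-diagonal {i = zero} {zero} i≢j = contradiction ≡.refl i≢j
  δ-off-diagonal {i = zero} {suc j} i≢j = K.refl
  δ-off-diagonal {i = suc i} {zero} i≢j = K.refl
  δ-off-diagonal {i = suc i} {suc j} i≢j = δ-off-diagonal (i≢j ∘ cong suc)

  -- Numbering the coefficient vectors by `Fin (q ^ d)` both counts combinations and turns
  -- quantifiers over coefficients into finite searches.
  coefficients : ∀ {d} → Fin (q ℕ.^ d) → Vector K.Carrier d
  coefficients c i = |K|.from (finToFun c i)

  code : ∀ {d} → Vector K.Carrier d → Fin (q ℕ.^ d)
  code a = funToFin (|K|.to ∘ a)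

  coefficients-code : ∀ {d} (a : Vector K.Carrier d) i → coefficients (code a) i ≈ a i
  coefficients-code a i = K.trans
    (K.reflexive (cong |K|.from (Fin.finToFun-funToFin (|K|.to ∘ a) i))) (|K|.strictlyInverseʳ (a i))

  coefficients-injective : ∀ {d} (c c′ : Fin (q ℕ.^ d)) →
                           (∀ i → coefficients {d} c i ≈ coefficients {d} c′ i) → c ≡ c′
  coefficients-injective {d} c c′ eq = ≡.trans (≡.sym (Fin.funToFin-finToFin {d} c)) (≡.trans
    (funToFin-cong {d} (λ i → Enumeration.injective |K|.enumeration (eq i)))
    (Fin.funToFin-finToFin {d} c′))

  combination-injective : ∀ {d} {b : Vector Carrierᴹ d} → LinearlyIndependent b → ∀ {a a′} →
                          combination a b ≈ᴹ combination a′ b → ∀ i → a i ≈ a′ i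
  combination-injective {b = b} independent {a} {a′} eq i =
    -- The difference of coefficients is `a i + - 1# * a′ i`, to which `combination-*` applies. The
    -- odd spelling `- 1# * - a′ i` of `a′ i` is chosen so that its negative is that second summand.
    K.trans (x∙y⁻¹≈ε⇒x≈y (a i) (- 1# * - a′ i) (K.trans (K.+-congˡ lemma) (independent _ difference≈0 i)))
            (K.trans (-1*x≈-x _) (⁻¹-involutive _))
    where
    open GroupProperties K.+-group
    open RingProperties K.ring using (-1*x≈-x)
    lemma : - (- 1# * - a′ i) ≈ - 1# * a′ i
    lemma = K.trans (K.-‿cong (K.trans (-1*x≈-x _) (⁻¹-involutive _))) (K.sym (-1*x≈-x _))
    difference≈0 : combination (λ i → a i + - 1# * a′ i) b ≈ᴹ 0ᴹ
    difference≈0 = begin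
      combination (λ i → a i + - 1# * a′ i) b                    ≈⟨ combination-+ b a _ ⟩
      combination a b +ᴹ combination (λ i → - 1# * a′ i) b       ≈⟨ +ᴹ-congˡ (combination-* b (- 1#) a′) ⟩
      combination a b +ᴹ (- 1#) *ₗ combination a′ b              ≈⟨ +ᴹ-cong eq (≈ᴹ-sym (-ᴹx≈-1x _)) ⟩
      combination a′ b +ᴹ -ᴹ combination a′ b                    ≈⟨ -ᴹ‿inverseʳ _ ⟩
      0ᴹ                                                         ∎

  -- The bridge from dimension to cardinality: a d-dimensional subspace has q^d elements.
  basis⇒enumeration : ∀ {W : Subspace p} {d} {b : Vector Carrierᴹ d} → IsBasis W b →
                      Enumeration ≈ᴹ-setoid ⟨ W ⟩ (q ℕ.^ d)
  basis⇒enumeration {W = W} {d} {b} isBasis = record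
    { enum = λ c → combination (coefficients c) b
    ; member = λ c → combination-closed W members (coefficients c)
    ; injective = λ {c} {c′} eq → coefficients-injective {d} c c′ (combination-injective independent eq)
    ; index = λ x∈W → code (proj₁ (spanning x∈W))
    ; enum-index = λ x∈W → ≈ᴹ-trans
        (combination-cong b (coefficients-code (proj₁ (spanning x∈W))))
        (≈ᴹ-sym (proj₂ (spanning x∈W)))
    }
    where open IsBasis isBasis

  abstract
    isCombination? : ∀ {d} (b : Vector Carrierᴹ d) x → Dec (IsCombination b x)
    isCombination? {d} b x = map′
      (λ (c , eq) → coefficients c , eq)
      (λ (a , eq) → code a , ≈ᴹ-trans eq (combination-cong b (λ i → K.sym (coefficients-code a i))))
      (Fin.any? (λ c → x |V|.≈? combination (coefficients {d} c) b))

  -- A hyperplane is given as a bare predicate; its basis makes membership a search through finitely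
  -- many combinations.
  finiteDimensional⇒decidable : ∀ {W : Subspace p} {d} → HasDimension W d → ∀ x → Dec (⟨ W ⟩ x)
  finiteDimensional⇒decidable {W = W} (b , isBasis) x = map′
    (λ (a , x≈) → Subspace.resp-≈ W (≈ᴹ-sym x≈) (combination-closed W members a))
    spanning (isCombination? b x)
    where open IsBasis isBasis

  abstract
    linearlyIndependent? : ∀ {d} (b : Vector Carrierᴹ d) → Dec (LinearlyIndependent b)
    linearlyIndependent? {d} b = map′
      (λ f a eq i → K.trans (K.sym (coefficients-code a i))
        (f (code a) (≈ᴹ-trans (combination-cong b (coefficients-code a)) eq) i))
      (λ independent c → independent (coefficients c))
      (Fin.all? (λ c → (combination (coefficients {d} c) b |V|.≈? 0ᴹ)
                        →-dec Fin.all? (λ i → coefficients {d} c i |K|.≈? 0#)))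

  combinations-isBasis : ∀ {d} {b : Vector Carrierᴹ d} → LinearlyIndependent b → IsBasis (Combinations b) b
  combinations-isBasis {b = b} independent = record
    { members = λ i → δ i , ≈ᴹ-sym (combination-δ b i)
    ; independent = independent ; spanning = λ x∈ → x∈ }

  -- A relation with a nonzero coefficient at x could be solved for x. Equality of scalars is
  -- decidable, so that coefficient is zero and the relation is one among b.
  ∷-independent : ∀ {d} {b : Vector Carrierᴹ d} {x} → LinearlyIndependent b →
                  ¬ IsCombination b x → LinearlyIndependent (x ∷ b)
  ∷-independent {b = b} {x} independent x∉ a eq = λ where
      zero → a₀≈0
      (suc i) → independent (a ∘ suc) (begin
        combination (a ∘ suc) b                   ≈⟨ +ᴹ-identityˡ _ ⟨
        0ᴹ +ᴹ combination (a ∘ suc) b             ≈⟨ +ᴹ-congʳ (*ₗ-zeroˡ x) ⟨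
        0# *ₗ x +ᴹ combination (a ∘ suc) b        ≈⟨ +ᴹ-congʳ (*ₗ-cong a₀≈0 ≈ᴹ-refl) ⟨
        a zero *ₗ x +ᴹ combination (a ∘ suc) b    ≈⟨ eq ⟩
        0ᴹ                                        ∎) i
    where
    a₀≈0 : a zero ≈ 0#
    a₀≈0 = decidable-stable (a zero |K|.≈? 0#) (λ a₀≉0 → x∉
      (Subspace.resp-≈ (Combinations b) (begin
        inverse a₀≉0 *ₗ ((- 1#) *ₗ combination (a ∘ suc) b)  ≈⟨ *ₗ-cong K.refl (-ᴹx≈-1x _) ⟨
        inverse a₀≉0 *ₗ (-ᴹ combination (a ∘ suc) b)         ≈⟨ *ₗ-cong K.refl (inverseˡ-unique _ _ eq) ⟨
        inverse a₀≉0 *ₗ (a zero *ₗ x)                        ≈⟨ *ₗ-assoc _ _ x ⟨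
        (inverse a₀≉0 * a zero) *ₗ x                         ≈⟨ *ₗ-cong (inverseˡ a₀≉0) ≈ᴹ-refl ⟩
        1# *ₗ x                                              ≈⟨ *ₗ-identityˡ x ⟩
        x                                                    ∎)
      (Subspace.*ₗ-closed (Combinations b) (inverse a₀≉0)
        (Subspace.*ₗ-closed (Combinations b) (- 1#) (a ∘ suc , ≈ᴹ-refl)))))
      where open GroupProperties +ᴹ-group

  q^d≤n : ∀ {d} {b : Vector Carrierᴹ d} → LinearlyIndependent b → q ℕ.^ d ≤ n
  q^d≤n independent = ⊆⇒≤ (basis⇒enumeration (combinations-isBasis independent)) |V|.enumeration _

  abstract
    -- The q^d combinations are distinct, and there are only n = q^d vectors.
    independent∧full⇒spanning : ∀ {d} {b : Vector Carrierᴹ d} → LinearlyIndependent b →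
                                q ℕ.^ d ≡ n → ∀ x → IsCombination b x
    independent∧full⇒spanning {b = b} independent ≡.refl x = ⊆∧≡⇒⊇
      (Subspace.resp-≈ (Combinations b))
      (basis⇒enumeration (combinations-isBasis independent)) |V|.enumeration _ {x} _

  abstract
    -- Greedy: adjoin a vector of W outside the combinations so far until a search finds none. The
    -- invariant n ≤ fuel + d makes n steps enough.
    decidable⇒finiteDimensional : (W : Subspace p) → (∀ x → Dec (⟨ W ⟩ x)) → ∃[ d ] HasDimension W d
    decidable⇒finiteDimensional W W? = extend n {b = λ ()} z≤n′ (λ ()) (λ _ _ ())
      where
      z≤n′ : n ≤ n ℕ.+ 0
      z≤n′ = ℕ.m≤m+n n 0
      extend : ∀ fuel {d} {b : Vector Carrierᴹ d} → n ≤ fuel ℕ.+ d → (∀ i → ⟨ W ⟩ (b i)) →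
               LinearlyIndependent b → ∃[ d ] HasDimension W d
      -- Out of fuel, n ≤ d < q^d, while independence gives q^d ≤ n.
      extend zero {d} n≤d b∈W independent = contradiction (q^d≤n independent)
        (ℕ.<⇒≱ (ℕ.≤-<-trans n≤d (d<q^d |K|.1<order d)))
      extend (suc fuel) {d} {b} n≤ b∈W independent
        with |V|.any? (λ {x} {y} x≈y (x∈W , x∉) → Subspace.resp-≈ W x≈y x∈W ,
                        λ y∈ → x∉ (Subspace.resp-≈ (Combinations b) (≈ᴹ-sym x≈y) y∈))
                      (λ x → W? x ×-dec ¬? (isCombination? b x))
      ... | yes (x , x∈W , x∉) = extend fuel {b = x ∷ b}
            (subst (n ≤_) (≡.sym (ℕ.+-suc fuel d)) n≤)
            (λ { zero → x∈W ; (suc i) → b∈W i }) (∷-independent independent x∉)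
      ... | no none = d , b , record
            { members = b∈W ; independent = independent
            ; spanning = λ {x} x∈W → decidable-stable (isCombination? b x) (λ x∉ → none (x , x∈W , x∉)) }

-- The cyclic multiplicative group and a subfield inside it.

enumeration⇒inverse : ∀ {A : Setoid c ℓ} {n} → Enumeration A (U {A = Setoid.Carrier A}) n →
                      Inverse A (≡.setoid (Fin n))
enumeration⇒inverse {A = A} e = record
  { to = λ x → index {x} _
  ; from = enum
  ; to-cong = λ x≈y → injective (A.trans (enum-index _) (A.trans x≈y (A.sym (enum-index _))))
  ; from-cong = λ i≡j → A.reflexive (cong enum i≡j)
  ; inverse = (λ y≈ → injective (A.trans (enum-index _) y≈))
            , (λ { ≡.refl → enum-index _ })
  }
  where
  open Enumeration e
  module A = Setoid A

module CyclicGroup {c ℓ} (L : Field c ℓ) {n} (|L|≡n : HasOrder L n)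
                   (α : Field.Carrier L) (α-generates : IsGenerator L α) where
  open Field L hiding (zero)
  open FieldProperties L
  open FiniteField L |L|≡n
  open ≈-Reasoning setoid

  α≉0 : ¬ (α ≈ 0#)
  α≉0 = proj₁ α-generates

  α^i≈α^[i+j]⇒α^j≈1 : ∀ i j → α ^ᶠ i ≈ α ^ᶠ (i ℕ.+ j) → α ^ᶠ j ≈ 1#
  α^i≈α^[i+j]⇒α^j≈1 i j eq = *-cancelˡ-nonZero (x^n≉0 α≉0 i) (begin
    α ^ᶠ i * α ^ᶠ j  ≈⟨ ^-homo-* α i j ⟨
    α ^ᶠ (i ℕ.+ j)   ≈⟨ eq ⟨
    α ^ᶠ i           ≈⟨ *-identityʳ _ ⟨
    α ^ᶠ i * 1#      ∎)

  α^[n∸1]≈1 : α ^ᶠ (n ∸ 1) ≈ 1#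
  α^[n∸1]≈1 = *-cancelˡ-nonZero α≉0 (begin
    α ^ᶠ suc (n ∸ 1)  ≡⟨ cong (α ^ᶠ_) (ℕ.m+[n∸m]≡n (ℕ.<⇒≤ 1<order)) ⟩
    α ^ᶠ n            ≈⟨ x^order≈x α ⟩
    α                 ≈⟨ *-identityʳ α ⟨
    α * 1#            ∎)

  α^[j*i]≈1 : ∀ {i} → α ^ᶠ i ≈ 1# → ∀ j → α ^ᶠ (j ℕ.* i) ≈ 1#
  α^[j*i]≈1 {i} α^i≈1 j = begin
    α ^ᶠ (j ℕ.* i)  ≡⟨ cong (α ^ᶠ_) (ℕ.*-comm j i) ⟩
    α ^ᶠ (i ℕ.* j)  ≈⟨ ^-assocʳ α i j ⟨
    (α ^ᶠ i) ^ᶠ j   ≈⟨ ^-congˡ j α^i≈1 ⟩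
    1# ^ᶠ j         ≈⟨ 1^n≈1 j ⟩
    1#              ∎

  α^i≈α^[i%j] : ∀ {j} .{{_ : NonZero j}} → α ^ᶠ j ≈ 1# → ∀ i → α ^ᶠ i ≈ α ^ᶠ (i % j)
  α^i≈α^[i%j] {j} α^j≈1 i = begin
    α ^ᶠ i                                  ≡⟨ cong (α ^ᶠ_) (m≡m%n+[m/n]*n i j) ⟩
    α ^ᶠ (i % j ℕ.+ i / j ℕ.* j)            ≈⟨ ^-homo-* α (i % j) _ ⟩
    α ^ᶠ (i % j) * α ^ᶠ (i / j ℕ.* j)       ≈⟨ *-congˡ (α^[j*i]≈1 α^j≈1 (i / j)) ⟩
    α ^ᶠ (i % j) * 1#                       ≈⟨ *-identityʳ _ ⟩
    α ^ᶠ (i % j)                            ∎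

  -- Exponents may be reduced modulo j, so every element is `0#` or one of the j powers α^0, ...,
  -- α^(j-1).
  α^j≈1⇒n≤1+j : ∀ j → .{{NonZero j}} → α ^ᶠ j ≈ 1# → n ≤ suc j
  α^j≈1⇒n≤1+j j α^j≈1 = Fin.injective⇒≤ {f = λ i → proj₁ (log (from i))} (λ {i} {i′} eq →
    Enumeration.injective enumeration (trans (proj₂ (log (from i)))
      (trans (reflexive (cong power eq)) (sym (proj₂ (log (from i′)))))))
    where
    power : Fin (suc j) → Carrier
    power zero = 0#
    power (suc i) = α ^ᶠ toℕ i
    log : ∀ x → ∃[ i ] x ≈ power i
    log x with x ≈? 0#
    ... | yes x≈0 = zero , x≈0
    ... | no x≉0 with proj₂ α-generates x x≉0
    ...   | k , x≈α^k = suc (fromℕ< (m%n<n k j)) , (begin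
      x                                     ≈⟨ x≈α^k ⟩
      α ^ᶠ k                                ≈⟨ α^i≈α^[i%j] α^j≈1 k ⟩
      α ^ᶠ (k % j)                          ≡⟨ cong (α ^ᶠ_) (Fin.toℕ-fromℕ< (m%n<n k j)) ⟨
      α ^ᶠ toℕ (fromℕ< (m%n<n k j))         ∎)

  -- The remainder of j modulo n - 1 also sends α to `1#`; a positive one would be too small for
  -- `α^j≈1⇒n≤1+j`.
  α^j≈1⇒n∸1∣j : ∀ j → α ^ᶠ j ≈ 1# → n ∸ 1 ∣ j
  α^j≈1⇒n∸1∣j j α^j≈1 = m%n≡0⇒n∣m j (n ∸ 1) (remainder≡0 (j % (n ∸ 1)) (m%n<n j (n ∸ 1))
    (trans (sym (α^i≈α^[i%j] α^[n∸1]≈1 j)) α^j≈1))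
    where
    instance _ = ℕ.>-nonZero (ℕ.m<n⇒0<n∸m 1<order)
    remainder≡0 : ∀ i → i < n ∸ 1 → α ^ᶠ i ≈ 1# → i ≡ 0
    remainder≡0 zero _ _ = ≡.refl
    remainder≡0 (suc i) i<n∸1 α^i≈1 = contradiction (α^j≈1⇒n≤1+j (suc i) α^i≈1)
      (ℕ.<⇒≱ (subst (suc (suc i) <_) (ℕ.m+[n∸m]≡n (ℕ.<⇒≤ 1<order)) (s≤s i<n∸1)))

-- The subfield of order 1 + o is realised as the fixed field of x ↦ x ^ (1 + o).
module FixedField {c ℓ} (L : Field c ℓ) {n} (|L|≡n : HasOrder L n)
                  (α : Field.Carrier L) (α-generates : IsGenerator L α)
                  (o b : ℕ) .{{_ : NonZero o}} (b*o≡n∸1 : b ℕ.* o ≡ n ∸ 1)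
                  (additive : AdditivePower L (suc o)) where
  open Field L hiding (zero)
  open FieldProperties L
  open FiniteField L |L|≡n
  open CyclicGroup L |L|≡n α α-generates
  open ≈-Reasoning setoid

  Fixed : Pred Carrier ℓ
  Fixed = FixedBy L (suc o)

  Fixed-resp : Fixed Respects _≈_
  Fixed-resp x≈y x∈F = trans (^-congˡ (suc o) (sym x≈y)) (trans x∈F x≈y)

  fixed? : ∀ x → Dec (Fixed x)
  fixed? x = x ^ᶠ suc o ≈? x

  0-fixed : Fixed 0#
  0-fixed = 0^n≈0 (suc o)

  1-fixed : Fixed 1#
  1-fixed = 1^n≈1 (suc o)

  +-fixed : ∀ {x y} → Fixed x → Fixed y → Fixed (x + y)
  +-fixed x∈F y∈F = trans (additive _ _) (+-cong x∈F y∈F)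

  *-fixed : ∀ {x y} → Fixed x → Fixed y → Fixed (x * y)
  *-fixed x∈F y∈F = trans (^-distrib-* _ _ (suc o)) (*-cong x∈F y∈F)

  -- Additivity of the power gives this without distinguishing the parity of the exponent.
  -‿fixed : ∀ {x} → Fixed x → Fixed (- x)
  -‿fixed {x} x∈F = begin
    (- x) ^ᶠ suc o                     ≈⟨ inverseˡ-unique _ _ sum≈0 ⟩
    - (x ^ᶠ suc o)                     ≈⟨ -‿cong x∈F ⟩
    - x                                ∎
    where
    open GroupProperties +-group using (inverseˡ-unique)
    sum≈0 : (- x) ^ᶠ suc o + x ^ᶠ suc o ≈ 0#
    sum≈0 = begin
      (- x) ^ᶠ suc o + x ^ᶠ suc o      ≈⟨ additive (- x) x ⟨
      (- x + x) ^ᶠ suc o               ≈⟨ ^-congˡ (suc o) (-‿inverseˡ x) ⟩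
      0# ^ᶠ suc o                      ≈⟨ 0-fixed ⟩
      0#                               ∎

  inverse-fixed : ∀ {x} (x≉0 : ¬ (x ≈ 0#)) → Fixed x → Fixed (inverse x≉0)
  inverse-fixed {x} x≉0 x∈F = *-cancelˡ-nonZero x≉0 (begin
    x * inverse x≉0 ^ᶠ suc o           ≈⟨ *-congʳ x∈F ⟨
    x ^ᶠ suc o * inverse x≉0 ^ᶠ suc o  ≈⟨ ^-distrib-* x _ (suc o) ⟨
    (x * inverse x≉0) ^ᶠ suc o         ≈⟨ ^-congˡ (suc o) x*x⁻¹≈1 ⟩
    1# ^ᶠ suc o                        ≈⟨ 1-fixed ⟩
    1#                                 ≈⟨ x*x⁻¹≈1 ⟨
    x * inverse x≉0                    ∎)
    where
    x*x⁻¹≈1 : x * inverse x≉0 ≈ 1#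
    x*x⁻¹≈1 = trans (*-comm _ _) (inverseˡ x≉0)

  private
    rawF : RawRing _ _
    rawF = record
      { Carrier = ∃ Fixed
      ; _≈_ = _≈_ on proj₁
      ; _+_ = λ (x , x∈F) (y , y∈F) → x + y , +-fixed x∈F y∈F
      ; _*_ = λ (x , x∈F) (y , y∈F) → x * y , *-fixed x∈F y∈F
      ; -_ = λ (x , x∈F) → - x , -‿fixed x∈F
      ; 0# = 0# , 0-fixed
      ; 1# = 1# , 1-fixed
      }

    inclusion-isRingHomomorphism : IsRingHomomorphism rawF rawRing proj₁
    inclusion-isRingHomomorphism = record
      { isSemiringHomomorphism = record
        { isNearSemiringHomomorphism = record
          { +-isMonoidHomomorphism = record
            { isMagmaHomomorphism = record
              { isRelHomomorphism = record { cong = λ x≈y → x≈y }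
              ; homo = λ _ _ → refl
              }
            ; ε-homo = refl
            }
          ; *-homo = λ _ _ → refl
          }
        ; 1#-homo = refl
        }
      ; -‿homo = λ _ → refl
      }

  F : Field _ _
  F = record
    { commutativeRing = record
      { isCommutativeRing = RingMonomorphism.isCommutativeRing
          (record { isRingHomomorphism = inclusion-isRingHomomorphism ; injective = λ x≈y → x≈y })
          isCommutativeRing
      }
    ; 1≉0 = 1≉0
    ; invertible = λ (x , x∈F) x≉0 →
        (inverse x≉0 , inverse-fixed x≉0 x∈F) , inverseˡ x≉0 , trans (*-comm _ _) (inverseˡ x≉0)
    }

  F⊆L : Extension F L
  F⊆L = record { embed = proj₁ ; isRingHomomorphism = inclusion-isRingHomomorphism }

  α^[j*b]-fixed : ∀ j → Fixed (α ^ᶠ (j ℕ.* b))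
  α^[j*b]-fixed j = begin
    α ^ᶠ (j ℕ.* b) * (α ^ᶠ (j ℕ.* b)) ^ᶠ o    ≈⟨ *-congˡ (^-assocʳ α (j ℕ.* b) o) ⟩
    α ^ᶠ (j ℕ.* b) * α ^ᶠ (j ℕ.* b ℕ.* o)     ≡⟨ cong (λ i → α ^ᶠ (j ℕ.* b) * α ^ᶠ i)
                                                   (≡.trans (ℕ.*-assoc j b o) (cong (j ℕ.*_) b*o≡n∸1)) ⟩
    α ^ᶠ (j ℕ.* b) * α ^ᶠ (j ℕ.* (n ∸ 1))     ≈⟨ *-congˡ (α^[j*i]≈1 α^[n∸1]≈1 j) ⟩
    α ^ᶠ (j ℕ.* b) * 1#                       ≈⟨ *-identityʳ _ ⟩
    α ^ᶠ (j ℕ.* b)                            ∎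

  abstract
    -- For x = α^e, being fixed means α^(e o) = 1, so b o = n - 1 divides e o and b divides e. The
    -- quotient is then reduced modulo o, since α^(b o) = 1.
    fixed⇒power : ∀ {x} → Fixed x → ¬ (x ≈ 0#) → Σ[ j ∈ Fin o ] x ≈ α ^ᶠ (toℕ j ℕ.* b)
    fixed⇒power {x} x∈F x≉0 with proj₂ α-generates x x≉0
    ... | e , x≈α^e with b∣e
      where
      α^[e*o]≈1 : α ^ᶠ (e ℕ.* o) ≈ 1#
      α^[e*o]≈1 = *-cancelˡ-nonZero x≉0 (begin
        x * α ^ᶠ (e ℕ.* o)  ≈⟨ *-congˡ (^-assocʳ α e o) ⟨
        x * (α ^ᶠ e) ^ᶠ o   ≈⟨ *-congˡ (^-congˡ o x≈α^e) ⟨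
        x * x ^ᶠ o          ≈⟨ x∈F ⟩
        x                   ≈⟨ *-identityʳ x ⟨
        x * 1#              ∎)
      b∣e : b ∣ e
      b∣e = *-cancelʳ-∣ o (subst (_∣ e ℕ.* o) (≡.sym b*o≡n∸1) (α^j≈1⇒n∸1∣j (e ℕ.* o) α^[e*o]≈1))
    ...   | divides j ≡.refl = fromℕ< (m%n<n j o) , (begin
      x                                               ≈⟨ x≈α^e ⟩
      α ^ᶠ (j ℕ.* b)                                  ≡⟨ cong (λ i → α ^ᶠ (i ℕ.* b)) (m≡m%n+[m/n]*n j o) ⟩
      α ^ᶠ ((j % o ℕ.+ j / o ℕ.* o) ℕ.* b)            ≡⟨ cong (α ^ᶠ_) exponent ⟩
      α ^ᶠ (j % o ℕ.* b ℕ.+ j / o ℕ.* (n ∸ 1))        ≈⟨ ^-homo-* α (j % o ℕ.* b) _ ⟩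
      α ^ᶠ (j % o ℕ.* b) * α ^ᶠ (j / o ℕ.* (n ∸ 1))   ≈⟨ *-congˡ (α^[j*i]≈1 α^[n∸1]≈1 (j / o)) ⟩
      α ^ᶠ (j % o ℕ.* b) * 1#                         ≈⟨ *-identityʳ _ ⟩
      α ^ᶠ (j % o ℕ.* b)                              ≡⟨ cong (λ i → α ^ᶠ (i ℕ.* b)) (Fin.toℕ-fromℕ< (m%n<n j o)) ⟨
      α ^ᶠ (toℕ (fromℕ< (m%n<n j o)) ℕ.* b)           ∎)
      where
      exponent : (j % o ℕ.+ j / o ℕ.* o) ℕ.* b ≡ j % o ℕ.* b ℕ.+ j / o ℕ.* (n ∸ 1)
      exponent = ≡.trans (ℕ.*-distribʳ-+ b (j % o) (j / o ℕ.* o)) (cong (j % o ℕ.* b ℕ.+_)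
        (≡.trans (ℕ.*-assoc (j / o) o b) (cong (j / o ℕ.*_) (≡.trans (ℕ.*-comm o b) b*o≡n∸1))))

  b-nonZero : NonZero b
  b-nonZero = ℕ.m*n≢0⇒m≢0 b {{ℕ.>-nonZero (subst (0 <_) (≡.sym b*o≡n∸1) (ℕ.m<n⇒0<n∸m 1<order))}}

  private
    -- Here α^((j - i) b) = 1, so b o divides (j - i) b and o divides j - i, which is less than o.
    α^[i*b]≈α^[j*b]⇒i≡j : ∀ {i j} → i ≤ j → j < o → α ^ᶠ (i ℕ.* b) ≈ α ^ᶠ (j ℕ.* b) → i ≡ j
    α^[i*b]≈α^[j*b]⇒i≡j {i} {j} i≤j j<o eq = ℕ.≤-antisym i≤j (ℕ.m∸n≡0⇒m≤n (multiple<o⇒≡0 (j ∸ i)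
      (*-cancelˡ-∣ b {{b-nonZero}} b*o∣b*[j∸i]) (ℕ.≤-<-trans (ℕ.m∸n≤m j i) j<o)))
      where
      multiple<o⇒≡0 : ∀ d → o ∣ d → d < o → d ≡ 0
      multiple<o⇒≡0 zero _ _ = ≡.refl
      multiple<o⇒≡0 (suc d) o∣d d<o = contradiction (∣⇒≤ o∣d) (ℕ.<⇒≱ d<o)
      α^[j∸i]b≈1 : α ^ᶠ ((j ∸ i) ℕ.* b) ≈ 1#
      α^[j∸i]b≈1 = α^i≈α^[i+j]⇒α^j≈1 (i ℕ.* b) _ (trans eq (^-congʳ α
        (≡.trans (cong (ℕ._* b) (≡.sym (ℕ.m+[n∸m]≡n i≤j))) (ℕ.*-distribʳ-+ b i (j ∸ i)))))
      b*o∣b*[j∸i] : b ℕ.* o ∣ b ℕ.* (j ∸ i)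
      b*o∣b*[j∸i] = ≡.subst₂ _∣_ (≡.sym b*o≡n∸1) (ℕ.*-comm (j ∸ i) b) (α^j≈1⇒n∸1∣j _ α^[j∸i]b≈1)

  α^[j*b]-injective : ∀ {i j : Fin o} → α ^ᶠ (toℕ i ℕ.* b) ≈ α ^ᶠ (toℕ j ℕ.* b) → i ≡ j
  α^[j*b]-injective {i} {j} eq with ℕ.≤-total (toℕ i) (toℕ j)
  ... | inj₁ i≤j = Fin.toℕ-injective (α^[i*b]≈α^[j*b]⇒i≡j i≤j (Fin.toℕ<n j) eq)
  ... | inj₂ j≤i = Fin.toℕ-injective (≡.sym (α^[i*b]≈α^[j*b]⇒i≡j j≤i (Fin.toℕ<n i) (sym eq)))

  abstract
    |F|≡1+o : HasOrder F (suc o)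
    |F|≡1+o = enumeration⇒inverse (record
      { enum = element
      ; member = _
      ; injective = element-injective _ _
      ; index = λ {x} _ → proj₁ (locate x)
      ; enum-index = λ {x} _ → proj₂ (locate x)
      })
      where
      element : Fin (suc o) → ∃ Fixed
      -- Index zero is reserved for `0#`; the o powers of α^b come after it.
      element zero = 0# , 0-fixed
      element (suc j) = α ^ᶠ (toℕ j ℕ.* b) , α^[j*b]-fixed (toℕ j)
      element-injective : ∀ i j → proj₁ (element i) ≈ proj₁ (element j) → i ≡ j
      element-injective zero zero eq = ≡.refl
      element-injective zero (suc j) eq = contradiction (sym eq) (x^n≉0 α≉0 (toℕ j ℕ.* b))
      element-injective (suc i) zero eq = contradiction eq (x^n≉0 α≉0 (toℕ i ℕ.* b))
      element-injective (suc i) (suc j) eq = cong suc (α^[j*b]-injective eq)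
      locate : ∀ (x : ∃ Fixed) → ∃[ i ] proj₁ (element i) ≈ proj₁ x
      locate (x , x∈F) with x ≈? 0#
      ... | yes x≈0 = zero , sym x≈0
      ... | no x≉0 with fixed⇒power x∈F x≉0
      ...   | j , x≈ = suc j , sym x≈

-- L as a vector space over K and over F.

^-injectiveʳ : ∀ {q} → 1 < q → ∀ {i j} → q ℕ.^ i ≡ q ℕ.^ j → i ≡ j
^-injectiveʳ {q} q>1 {i} {j} eq with ℕ.<-cmp i j
... | tri< i<j _ _ = contradiction eq (ℕ.<⇒≢ (ℕ.^-monoʳ-< q q>1 i<j))
... | tri≈ _ i≡j _ = i≡j
... | tri> _ _ j<i = contradiction (≡.sym eq) (ℕ.<⇒≢ (ℕ.^-monoʳ-< q q>1 j<i))

module Tower {c₁ ℓ₁ c₂ ℓ₂} (K : Field c₁ ℓ₁) {q} (|K|≡q : HasOrder K q)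
             (L : Field c₂ ℓ₂) {n} (|L|≡n : HasOrder L n) (E : Extension K L)
             (α : Field.Carrier L) (α-generates : IsGenerator L α)
             (o b : ℕ) .{{_ : NonZero o}} (b*o≡n∸1 : b ℕ.* o ≡ n ∸ 1)
             (additive : AdditivePower L (suc o))
             (K-fixed : ∀ a → FixedBy L (suc o) (Extension.embed E a)) where
  open Field L hiding (zero)
  open Extension E using (embed)
  open FieldProperties L
  open Finite |L|≡n
  open CyclicGroup L |L|≡n α α-generates using (α≉0)
  open FixedField L |L|≡n α α-generates o b b*o≡n∸1 additive
  open GroupProperties +-group using (x∙y⁻¹≈ε⇒x≈y)
  open RingProperties ring using (x[y-z]≈xy-xz; [y-z]x≈yx-zx)
  open AbelianGroupProperties +-abelianGroup using (⁻¹-∙-comm)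
  open ≈-Reasoning setoid
  module LK = Linear K (Extension.vectorSpace E)
  module LF = Linear F (Extension.vectorSpace F⊆L)
  module SK = FiniteSpace K |K|≡q (Extension.vectorSpace E) |L|≡n
  module SF = FiniteSpace F |F|≡1+o (Extension.vectorSpace F⊆L) |L|≡n
  open LK.Subspace
  open LK using (⟨_⟩)

  restrict : LF.Subspace p → LK.Subspace p
  restrict W = record
    { ⟨_⟩ = W.⟨_⟩ ; resp-≈ = W.resp-≈ ; 0∈ = W.0∈ ; +-closed = W.+-closed
    ; *ₗ-closed = λ a → W.*ₗ-closed (embed a , K-fixed a) }
    where module W = LF.Subspace W

  -- F seen as a K-subspace of L: a K-basis of it records each K-functional on F by a coordinate
  -- vector.
  FixedSpace : LK.Subspace ℓ₂
  FixedSpace = record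
    { ⟨_⟩ = Fixed ; resp-≈ = Fixed-resp ; 0∈ = 0-fixed ; +-closed = +-fixed
    ; *ₗ-closed = λ a → *-fixed (K-fixed a) }

  core : LK.Subspace p → LF.Subspace (c₂ ⊔ ℓ₂ ⊔ p)
  core H = record
    { ⟨_⟩ = λ x → ∀ c → Fixed c → ⟨ H ⟩ (c * x)
    ; resp-≈ = λ x≈y x∈ c c∈F → resp-≈ H (*-congˡ x≈y) (x∈ c c∈F)
    ; 0∈ = λ c c∈F → resp-≈ H (sym (zeroʳ c)) (0∈ H)
    ; +-closed = λ x∈ y∈ c c∈F → resp-≈ H (sym (distribˡ c _ _)) (+-closed H (x∈ c c∈F) (y∈ c c∈F))
    ; *ₗ-closed = λ (d , d∈F) x∈ c c∈F → resp-≈ H (*-assoc c d _) (x∈ (c * d) (*-fixed c∈F d∈F))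
    }

  core⊆ : ∀ (H : LK.Subspace p) {x} → LF.⟨ core H ⟩ x → ⟨ H ⟩ x
  core⊆ H x∈ = resp-≈ H (*-identityˡ _) (x∈ 1# 1-fixed)

  core? : (H : LK.Subspace p) → (∀ x → Dec (⟨ H ⟩ x)) → ∀ x → Dec (LF.⟨ core H ⟩ x)
  core? H H? x = all?
    (λ c≈d c∈ d∈F → resp-≈ H (*-congʳ c≈d) (c∈ (Fixed-resp (sym c≈d) d∈F)))
    (λ c → fixed? c →-dec H? (c * x))

  private
    subtract-common : ∀ s h h′ → (s + h) - (s + h′) ≈ h - h′
    subtract-common s h h′ = begin
      (s + h) - (s + h′)       ≈⟨ +-congˡ (⁻¹-∙-comm s h′) ⟨
      (s + h) + (- s - h′)     ≈⟨ +-assoc _ _ _ ⟨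
      ((s + h) - s) - h′       ≈⟨ +-congʳ (trans (+-congʳ (+-comm s h)) (trans (+-assoc h s (- s))
                                   (trans (+-congˡ (-‿inverseʳ s)) (+-identityʳ h)))) ⟩
      h - h′                   ∎

    [x-y]+y≈x : ∀ x y → (x - y) + y ≈ x
    [x-y]+y≈x x y = trans (+-assoc x (- y) y) (trans (+-congˡ (-‿inverseˡ y)) (+-identityʳ x))

  -- The core of a hyperplane and its dimension.

  module Hyperplanes {d} (q^[1+d]≡n : q ℕ.^ suc d ≡ n)
                     (H : LK.Subspace p) (H-dimension : LK.HasDimension H d) where
    private
      1<q : 1 < q
      1<q = FiniteField.1<order K |K|≡q

      H? : ∀ x → Dec (⟨ H ⟩ x)
      H? = SK.finiteDimensional⇒decidable {W = H} H-dimension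

      h : Vector Carrier d
      h = proj₁ H-dimension

      open LK.IsBasis (proj₂ H-dimension)

    abstract
      -- H has q^d elements, fewer than the q^(1+d) of L, so the search for a vector outside it
      -- succeeds.
      outside : ∃[ v ] ¬ ⟨ H ⟩ v
      outside with any? (λ x≈y x∉H y∈H → x∉H (resp-≈ H (sym x≈y) y∈H)) (λ x → ¬? (H? x))
      ... | yes found = found
      ... | no none = contradiction
        (⊆⇒≤ enumeration (SK.basis⇒enumeration {W = H} (proj₂ H-dimension))
             (λ {x} _ → decidable-stable (H? x) (λ x∉H → none (x , x∉H))))
        (ℕ.<⇒≱ (subst (q ℕ.^ d <_) q^[1+d]≡n (ℕ.^-monoʳ-< q 1<q (ℕ.n<1+n d))))

    module Complement {v} (v∉H : ¬ ⟨ H ⟩ v) where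
      private
        coordinates : ∀ y → SK.IsCombination (v ∷ h) y
        coordinates = SK.independent∧full⇒spanning {b = v ∷ h} (SK.∷-independent independent
          (λ (a , v≈) → v∉H (resp-≈ H (sym v≈) (SK.combination-closed H members a)))) q^[1+d]≡n

      -- The linear functional with kernel H and value 1 at v.
      functional : Carrier → Field.Carrier K
      functional y = proj₁ (coordinates y) zero

      -- When the coordinates at v agree, they cancel in y - z and leave a difference of
      -- combinations of h.
      functional-≈⇒-∈H : ∀ y z → Field._≈_ K (functional y) (functional z) → ⟨ H ⟩ (y - z)
      functional-≈⇒-∈H y z fy≈fz = resp-≈ H difference
        (SK.difference-closed H (SK.combination-closed H members (a ∘ suc))
                                (SK.combination-closed H members (a′ ∘ suc)))
        where
        a a′ : Vector (Field.Carrier K) (suc d)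
        a = proj₁ (coordinates y)
        a′ = proj₁ (coordinates z)
        open IsRingHomomorphism (Extension.isRingHomomorphism E) using (⟦⟧-cong)
        difference : LK.combination (a ∘ suc) h - LK.combination (a′ ∘ suc) h ≈ y - z
        difference = begin
          LK.combination (a ∘ suc) h - LK.combination (a′ ∘ suc) h
            ≈⟨ subtract-common (embed (functional y) * v) _ _ ⟨
          (embed (functional y) * v + LK.combination (a ∘ suc) h)
            - (embed (functional y) * v + LK.combination (a′ ∘ suc) h)
            ≈⟨ +-cong (sym (proj₂ (coordinates y))) (-‿cong (trans
                 (+-congʳ (*-congʳ (⟦⟧-cong fy≈fz))) (sym (proj₂ (coordinates z))))) ⟩
          y - z ∎

      private
        module BasisOfF {e} (u : Vector Carrier e) (u-isBasis : LK.IsBasis FixedSpace u) where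
          module u = LK.IsBasis u-isBasis

          -- The x with x z in H form a K-subspace; containing the basis u of F, it contains F.
          ∈core-from-basis : ∀ z → (∀ s → ⟨ H ⟩ (u s * z)) → LF.⟨ core H ⟩ z
          ∈core-from-basis z uz∈H c c∈F = resp-≈ H (*-congʳ (sym (proj₂ (u.spanning c∈F))))
            (SK.combination-closed preimage uz∈H (proj₁ (u.spanning c∈F)))
            where
            preimage : LK.Subspace _
            preimage = record
              { ⟨_⟩ = λ x → ⟨ H ⟩ (x * z)
              ; resp-≈ = λ x≈y → resp-≈ H (*-congʳ x≈y)
              ; 0∈ = resp-≈ H (sym (zeroˡ z)) (0∈ H)
              ; +-closed = λ x∈ y∈ → resp-≈ H (sym (distribʳ z _ _)) (+-closed H x∈ y∈)
              ; *ₗ-closed = λ a x∈ → resp-≈ H (sym (*-assoc _ _ z)) (*ₗ-closed H a x∈)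
              }

          open Enumeration (SK.basis⇒enumeration {W = FixedSpace} u-isBasis)

          -- The K-functional c ↦ f(c y) on F, recorded by its values on u. There are q^e possible
          -- records, as many as elements of F.
          value : Carrier → Vector (Field.Carrier K) e
          value y s = functional (u s * y)

          values : Carrier → Fin (q ℕ.^ e)
          values y = SK.code (value y)

          values-≡⇒∈core : ∀ y z → values y ≡ values z → LF.⟨ core H ⟩ (y - z)
          values-≡⇒∈core y z eq = ∈core-from-basis (y - z) (λ s →
            resp-≈ H (sym (x[y-z]≈xy-xz (u s) y z)) (functional-≈⇒-∈H (u s * y) (u s * z)
              (Field.trans K (Field.sym K (SK.coefficients-code (value y) s))
                (Field.trans K (Field.reflexive K (cong (λ c → SK.coefficients {e} c s) eq))
                  (SK.coefficients-code (value z) s)))))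

          -- If the functionals of two multiples of v agree, the difference x of the factors has x v
          -- in the core; a nonzero x would have its inverse in F and bring v into H.
          values-injective : Injective _≡_ _≡_ (λ i → values (enum i * v))
          values-injective {i} {j} eq = injective (x∙y⁻¹≈ε⇒x≈y _ _
            (decidable-stable (enum i - enum j ≈? 0#) (λ x≉0 → v∉H
              (resp-≈ H (inverse*[x*y]≈y x≉0 v) (resp-≈ (restrict (core H)) (sym ([y-z]x≈yx-zx v _ _))
                (values-≡⇒∈core _ _ eq) (inverse x≉0)
                (inverse-fixed x≉0 (+-fixed (member i) (-‿fixed (member j)))))))))

          decompose : ∀ y → ∃[ x ] Fixed x × LF.⟨ core H ⟩ (y - x * v)
          decompose y with injective⇒onto values-injective (values y)
          ... | i , eq = enum i , member i , values-≡⇒∈core y _ (≡.sym eq)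

      -- With f the functional, c ↦ (f (c v u₁), …, f (c v uₑ)), for u a K-basis of F,
      -- is injective on F, hence onto Kᵉ as |F| = |K|ᵉ; so L = core H ⊕ F v.
      abstract
        core-complement : ∀ y → ∃[ x ] Fixed x × LF.⟨ core H ⟩ (y - x * v)
        core-complement = BasisOfF.decompose (proj₁ (proj₂ dimension)) (proj₂ (proj₂ dimension))
          where
          dimension : ∃[ e ] LK.HasDimension FixedSpace e
          dimension = SK.decidable⇒finiteDimensional FixedSpace fixed?

      -- An F-basis w of the core, extended by v, is an F-basis of L: v lies outside the core, and
      -- `core-complement` gives spanning. Each half yields one inequality.
      core-∷-size : ∀ {e} → LF.HasDimension (core H) e → suc o ℕ.^ suc e ≡ n
      core-∷-size {e} (w , w-isBasis) = ℕ.≤-antisym (SF.q^d≤n {d = suc e} {b = v ∷ w} v∷w-independent)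
        (⊆⇒≤ enumeration
          (SF.basis⇒enumeration {W = SF.Combinations (v ∷ w)} {d = suc e} {b = v ∷ w}
            (SF.combinations-isBasis {b = v ∷ w} v∷w-independent))
          (λ {y} _ → v∷w-spanning y))
        where
        open LF.IsBasis w-isBasis renaming
          (members to w∈core; independent to w-independent; spanning to w-spanning)
        v∷w-independent : LF.LinearlyIndependent (v ∷ w)
        v∷w-independent = SF.∷-independent {b = w} {x = v} w-independent (λ (a , v≈) → v∉H (core⊆ H
          (LF.Subspace.resp-≈ (core H) (sym v≈) (SF.combination-closed (core H) w∈core a))))
        v∷w-spanning : ∀ y → SF.IsCombination (v ∷ w) y
        v∷w-spanning y = (proj₁ x , proj₁ (proj₂ x)) ∷ proj₁ a , (begin
          y                                                  ≈⟨ [x-y]+y≈x y (proj₁ x * v) ⟨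
          (y - proj₁ x * v) + proj₁ x * v                    ≈⟨ +-comm _ _ ⟩
          proj₁ x * v + (y - proj₁ x * v)                    ≈⟨ +-congˡ (proj₂ a) ⟩
          proj₁ x * v + LF.combination (proj₁ a) w           ∎)
          where
          x : ∃[ x ] Fixed x × LF.⟨ core H ⟩ (y - x * v)
          x = core-complement y
          a : SF.IsCombination w (y - proj₁ x * v)
          a = w-spanning {y - proj₁ x * v} (proj₂ (proj₂ x))

    abstract
      -- The search finds a basis of unknown length e; comparing (1+o)^(1+e) with (1+o)^t fixes e.
      core-dimension : ∀ {t} → suc o ℕ.^ t ≡ n → LF.HasDimension (core H) (t ∸ 1)
      core-dimension {t} eq = subst (LF.HasDimension (core H)) (cong (_∸ 1) e+1≡t) (proj₂ dimension)
        where
        dimension : ∃[ e ] LF.HasDimension (core H) e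
        dimension = SF.decidable⇒finiteDimensional (core H) (core? H H?)
        e+1≡t : suc (proj₁ dimension) ≡ t
        e+1≡t = ^-injectiveʳ (FiniteField.1<order F |F|≡1+o) {suc (proj₁ dimension)} {t}
          (≡.trans (Complement.core-∷-size (proj₂ outside) {proj₁ dimension} (proj₂ dimension)) (≡.sym eq))

  -- F-subspaces as spans of cosets.

  span⊆ : ∀ {p′} {X : Pred Carrier p} (V : LK.Subspace p′) → X ⊆ ⟨ V ⟩ → ⟨ LK.Span X ⟩ ⊆ ⟨ V ⟩
  span⊆ V X⊆V (LK.inject x∈X) = X⊆V x∈X
  span⊆ V X⊆V (LK.resp-≈ x≈y x∈) = resp-≈ V x≈y (span⊆ V X⊆V x∈)
  span⊆ V X⊆V LK.0∈ = 0∈ V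
  span⊆ V X⊆V (LK.+-closed x∈ y∈) = +-closed V (span⊆ V X⊆V x∈) (span⊆ V X⊆V y∈)
  span⊆ V X⊆V (LK.*ₗ-closed a x∈) = *ₗ-closed V a (span⊆ V X⊆V x∈)

  -- Shaped so that it unfolds to the same type as `S` once o and b take their values in the
  -- theorem.
  Coset : Fin b → Pred Carrier ℓ₂
  Coset i x = Σ[ j ∈ Fin o ] x ≈ α ^ᶠ (toℕ i ℕ.+ toℕ j ℕ.* b)

  multiple∈Coset : ∀ {c x} i → Fixed c → ¬ (c ≈ 0#) → x ≈ c * α ^ᶠ toℕ i → Coset i x
  multiple∈Coset {c} {x} i c∈F c≉0 x≈ with fixed⇒power c∈F c≉0
  ... | j , c≈ = j , (begin
    x                                         ≈⟨ x≈ ⟩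
    c * α ^ᶠ toℕ i                            ≈⟨ *-congʳ c≈ ⟩
    α ^ᶠ (toℕ j ℕ.* b) * α ^ᶠ toℕ i           ≈⟨ *-comm _ _ ⟩
    α ^ᶠ toℕ i * α ^ᶠ (toℕ j ℕ.* b)           ≈⟨ ^-homo-* α (toℕ i) _ ⟨
    α ^ᶠ (toℕ i ℕ.+ toℕ j ℕ.* b)              ∎)

  -- The coset in the form F* α^i, with the factor from F explicit for linear algebra over F.
  IsMultipleOf : Fin b → Pred Carrier (c₂ ⊔ ℓ₂)
  IsMultipleOf i x = ∃[ c ] Fixed c × ¬ (c ≈ 0#) × x ≈ c * α ^ᶠ toℕ i

  -- Divide the exponent of x by b: the remainder is the coset index, and the multiple of b yields
  -- the factor from F.
  coset-of : ∀ {x} → ¬ (x ≈ 0#) → ∃[ i ] IsMultipleOf i x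
  coset-of {x} x≉0 with proj₂ α-generates x x≉0
  ... | e , x≈α^e =
    fromℕ< (m%n<n e b) , α ^ᶠ (e / b ℕ.* b) , α^[j*b]-fixed (e / b) , x^n≉0 α≉0 (e / b ℕ.* b) , (begin
    x                                                     ≈⟨ x≈α^e ⟩
    α ^ᶠ e                                                ≡⟨ cong (α ^ᶠ_) (m≡m%n+[m/n]*n e b) ⟩
    α ^ᶠ (e % b ℕ.+ e / b ℕ.* b)                          ≈⟨ ^-homo-* α (e % b) _ ⟩
    α ^ᶠ (e % b) * α ^ᶠ (e / b ℕ.* b)                     ≈⟨ *-comm _ _ ⟩
    α ^ᶠ (e / b ℕ.* b) * α ^ᶠ (e % b)                     ≡⟨ cong (λ i → α ^ᶠ (e / b ℕ.* b) * α ^ᶠ i)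
                                                               (Fin.toℕ-fromℕ< (m%n<n e b)) ⟨
    α ^ᶠ (e / b ℕ.* b) * α ^ᶠ toℕ (fromℕ< (m%n<n e b))    ∎)
    where instance _ = b-nonZero

  F-combination-closed : ∀ (V : LK.Subspace p) {d} (a : Vector (Field.Carrier F) d) (w : Vector Carrier d) →
                         (∀ s → ⟨ V ⟩ (proj₁ (a s) * w s)) → ⟨ V ⟩ (LF.combination a w)
  F-combination-closed V {zero} a w aw∈V = 0∈ V
  F-combination-closed V {suc d} a w aw∈V =
    +-closed V (aw∈V zero) (F-combination-closed V (a ∘ suc) (w ∘ suc) (aw∈V ∘ suc))

  module CosetBasis {W : LF.Subspace p} {d} {w : Vector Carrier d} (w-isBasis : LF.IsBasis W w) where
    open LF.IsBasis w-isBasis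

    private
      w≉0 : ∀ s → ¬ (w s ≈ 0#)
      -- Otherwise the unit vector `SF.δ s` would be a relation with coefficient `1#` at s.
      w≉0 s ws≈0 = 1≉0 (trans (sym (SF.δ-diagonal s))
        (independent (SF.δ s) (trans (SF.combination-δ w s) ws≈0) s))

    abstract
      cosetIndex : Fin d → Fin b
      cosetIndex s = proj₁ (coset-of (w≉0 s))

      ∈coset : ∀ s → IsMultipleOf (cosetIndex s) (w s)
      ∈coset s = proj₂ (coset-of (w≉0 s))

    -- Two basis vectors in one coset are proportional over F: c′ w_s = c w_s′. Comparing
    -- coefficients at s gives c′ = 0 unless s and s′ agree.
    cosetIndex-injective : Injective _≡_ _≡_ cosetIndex
    cosetIndex-injective {s} {s′} eq = decidable-stable (s Fin.≟ s′) (proportional (∈coset s) (∈coset s′))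
      where
      i = cosetIndex s
      i′ = cosetIndex s′
      proportional : IsMultipleOf i (w s) → IsMultipleOf i′ (w s′) → ¬ ¬ (s ≡ s′)
      proportional (c , c∈F , c≉0 , ws≈) (c′ , c′∈F , c′≉0 , ws′≈) s≢s′ = c′≉0 (begin
        c′                          ≈⟨ *-identityʳ c′ ⟨
        c′ * 1#                     ≈⟨ *-congˡ (SF.δ-diagonal s) ⟨
        c′ * proj₁ (SF.δ s s)       ≈⟨ SF.combination-injective independent
                                         {scaled c′∈F s} {scaled c∈F s′} same s ⟩
        c * proj₁ (SF.δ s′ s)       ≈⟨ *-congˡ (SF.δ-off-diagonal (s≢s′ ∘ ≡.sym)) ⟩
        c * 0#                      ≈⟨ zeroʳ c ⟩
        0#                          ∎)
        where
        scaled : ∀ {c} → Fixed c → Fin d → Vector (Field.Carrier F) d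
        scaled {c} c∈F s s″ = Field._*_ F (c , c∈F) (SF.δ s s″)
        combination-scaled : ∀ {c} (c∈F : Fixed c) s → LF.combination (scaled c∈F s) w ≈ c * w s
        combination-scaled {c} c∈F s =
          trans (SF.combination-* w (c , c∈F) (SF.δ s)) (*-congˡ (SF.combination-δ w s))
        same : LF.combination (scaled c′∈F s) w ≈ LF.combination (scaled c∈F s′) w
        same = begin
          LF.combination (scaled c′∈F s) w   ≈⟨ combination-scaled c′∈F s ⟩
          c′ * w s                           ≈⟨ *-congˡ ws≈ ⟩
          c′ * (c * α ^ᶠ toℕ i)              ≈⟨ *-assoc c′ c _ ⟨
          c′ * c * α ^ᶠ toℕ i                ≈⟨ *-congʳ (*-comm c′ c) ⟩
          c * c′ * α ^ᶠ toℕ i                ≈⟨ *-assoc c c′ _ ⟩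
          c * (c′ * α ^ᶠ toℕ i)              ≡⟨ cong (λ k → c * (c′ * α ^ᶠ toℕ k)) eq ⟩
          c * (c′ * α ^ᶠ toℕ i′)             ≈⟨ *-congˡ ws′≈ ⟨
          c * w s′                           ≈⟨ combination-scaled c∈F s′ ⟨
          LF.combination (scaled c∈F s′) w   ∎

    coset⊆ : ∀ s → Coset (cosetIndex s) ⊆ LF.⟨ W ⟩
    coset⊆ s {x} (j , x≈) with ∈coset s
    ... | c , c∈F , c≉0 , ws≈ = LF.Subspace.resp-≈ W
      (begin
        -- The representative α^i is c⁻¹ w_s, an F-multiple of a basis vector of W.
        α ^ᶠ (toℕ j ℕ.* b) * (inverse c≉0 * w s)                      ≈⟨ *-congˡ (*-congˡ ws≈) ⟩
        α ^ᶠ (toℕ j ℕ.* b) * (inverse c≉0 * (c * α ^ᶠ toℕ i))         ≈⟨ *-congˡ (inverse*[x*y]≈y c≉0 _) ⟩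
        α ^ᶠ (toℕ j ℕ.* b) * α ^ᶠ toℕ i                               ≈⟨ *-comm _ _ ⟩
        α ^ᶠ toℕ i * α ^ᶠ (toℕ j ℕ.* b)                               ≈⟨ ^-homo-* α (toℕ i) _ ⟨
        α ^ᶠ (toℕ i ℕ.+ toℕ j ℕ.* b)                                  ≈⟨ x≈ ⟨
        x                                                             ∎)
      (LF.Subspace.*ₗ-closed W (α ^ᶠ (toℕ j ℕ.* b) , α^[j*b]-fixed (toℕ j))
        (LF.Subspace.*ₗ-closed W (inverse c≉0 , inverse-fixed c≉0 c∈F) (members s)))
      where i = cosetIndex s

    CosetSpan : LK.Subspace (c₁ ⊔ c₂ ⊔ ℓ₂)
    CosetSpan = LK.Span (⋃ (Fin d) (λ s → Coset (cosetIndex s)))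

    cosetSpan⊆ : ⟨ CosetSpan ⟩ ⊆ LF.⟨ W ⟩
    cosetSpan⊆ = span⊆ (restrict W) (λ (s , x∈) → coset⊆ s x∈)

    -- `CosetSpan` is closed only under K, but an F-coefficient can be absorbed: a nonzero
    -- F-multiple of w_s stays in the coset of w_s. A zero coefficient contributes the zero vector.
    ⊆cosetSpan : LF.⟨ W ⟩ ⊆ ⟨ CosetSpan ⟩
    ⊆cosetSpan x∈W = resp-≈ CosetSpan (sym (proj₂ (spanning x∈W)))
      (F-combination-closed CosetSpan a w multiple∈)
      where
      a = proj₁ (spanning x∈W)
      multiple∈ : ∀ s → ⟨ CosetSpan ⟩ (proj₁ (a s) * w s)
      multiple∈ s with proj₁ (a s) ≈? 0# | ∈coset s
      ... | yes a≈0 | _ = LK.resp-≈ (sym (trans (*-congʳ a≈0) (zeroˡ (w s)))) LK.0∈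
      ... | no a≉0 | c , c∈F , c≉0 , ws≈ = LK.inject (s , multiple∈Coset (cosetIndex s)
        (*-fixed (proj₂ (a s)) c∈F) (c≉0 ∘ x*y≈0⇒y≈0 a≉0) (trans (*-congˡ ws≈) (sym (*-assoc _ _ _))))

    -- The span has the same elements as W, so a K-basis of W serves; counting W over K and over F
    -- determines its length.
    cosetSpan-dimension : ∀ D → q ℕ.^ D ≡ suc o ℕ.^ d → LK.HasDimension CosetSpan D
    cosetSpan-dimension D q^D≡ = subst (LK.HasDimension CosetSpan) e≡D
      (u , record { members = λ i → ⊆cosetSpan (u.members i) ; independent = u.independent
                  ; spanning = λ x∈ → u.spanning (cosetSpan⊆ x∈) })
      where
      dimension : ∃[ e ] LK.HasDimension (restrict W) e
      dimension = SK.decidable⇒finiteDimensional (restrict W)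
        (SF.finiteDimensional⇒decidable {W = W} (w , w-isBasis))
      e = proj₁ dimension
      u = proj₁ (proj₂ dimension)
      module u = LK.IsBasis (proj₂ (proj₂ dimension))
      e≡D : e ≡ D
      e≡D = ^-injectiveʳ (FiniteField.1<order K |K|≡q) {e} {D} (≡.trans
        (size-unique (SK.basis⇒enumeration {W = restrict W} {d = e} (proj₂ (proj₂ dimension)))
                     (SF.basis⇒enumeration {W = W} w-isBasis))
        (≡.sym q^D≡))

  -- Being closed under F, core H lies in core H′ as soon as it lies in H′; the two have equal size.
  core-⊆⇒⊇ : ∀ {p′ d} (H : LK.Subspace p) (H′ : LK.Subspace p′) →
             LF.HasDimension (core H) d → LF.HasDimension (core H′) d →
             LF.⟨ core H ⟩ ⊆ ⟨ H′ ⟩ → LF.⟨ core H′ ⟩ ⊆ LF.⟨ core H ⟩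
  core-⊆⇒⊇ H H′ (_ , w) (_ , w′) core⊆H′ = ⊆∧≡⇒⊇ (LF.Subspace.resp-≈ (core H))
    (SF.basis⇒enumeration {W = core H} w) (SF.basis⇒enumeration {W = core H′} w′)
    (λ x∈ c c∈F → core⊆H′ (LF.Subspace.*ₗ-closed (core H) (c , c∈F) x∈))

-- Choice of representatives and the partition of the hyperplanes.

open import Data.Nat.Base using (_*_; _^_)
open import Relation.Binary.PropositionalEquality using (refl; sym; trans)

-- Greedy: a value is kept when it is related to none of those already kept. As f depends on a proof
-- of P i, covering is stated for the proof found by deciding P.
transversal : ∀ {a r p} {A : Set a} (R : A → A → Set r) → (∀ {x} → R x x) → Symmetric R → Decidable R →
              ∀ {n} {P : Pred (Fin n) p} → (∀ i → Dec (P i)) → (f : ∀ i → P i → A) →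
              Σ[ N ∈ ℕ ] Σ[ g ∈ (Fin N → A) ]
                (∀ i j → i ≢ j → ¬ R (g i) (g j)) × (∀ i → P i → Σ[ p ∈ P i ] ∃[ j ] R (g j) (f i p))
transversal R R-refl R-sym R? {zero} P? f = 0 , (λ ()) , (λ ()) , (λ ())
transversal R R-refl R-sym R? {suc n} P? f
  with transversal R R-refl R-sym R? (P? ∘ suc) (f ∘ suc) | P? zero
... | N , g , distinct , covering | no ¬P₀ =
  N , g , distinct , λ { zero P₀ → contradiction P₀ ¬P₀ ; (suc i) → covering i }
... | N , g , distinct , covering | yes P₀ with Fin.any? (λ j → R? (g j) (f zero P₀))
...   | yes represented = N , g , distinct , λ { zero _ → P₀ , represented ; (suc i) → covering i }
...   | no new = suc N , f zero P₀ ∷ g , distinct′ , covering′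
  where
  distinct′ : ∀ i j → i ≢ j → ¬ R ((f zero P₀ ∷ g) i) ((f zero P₀ ∷ g) j)
  distinct′ zero zero 0≢0 _ = 0≢0 refl
  distinct′ zero (suc j) _ related = new (j , R-sym related)
  distinct′ (suc i) zero _ related = new (i , related)
  distinct′ (suc i) (suc j) i≢j = distinct i j (i≢j ∘ cong suc)
  covering′ : ∀ i → _ → Σ[ p ∈ _ ] ∃[ j ] R ((f zero P₀ ∷ g) j) (f i p)
  covering′ zero _ = P₀ , zero , R-refl
  covering′ (suc i) Pᵢ with covering i Pᵢ
  ... | p , j , related = p , suc j , related

-- By induction, as (1+o)^(t+1) - 1 = ((1+o)^t - 1) + o (1+o)^t. It makes the division defining `β`
-- exact.
o∣[1+o]^t∸1 : ∀ o t → o ∣ suc o ^ t ∸ 1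
o∣[1+o]^t∸1 o zero = o ∣0
o∣[1+o]^t∸1 o (suc t) = subst (o ∣_) (sym (ℕ.+-∸-comm (o * suc o ^ t) (ℕ.m^n>0 (suc o) t)))
  (∣m∣n⇒∣m+n (o∣[1+o]^t∸1 o t) (m∣m*n (suc o ^ t)))

theorem18 :
    ∀ {c₁ ℓ₁ c₂ ℓ₂ : Level}
    (q k t m : ℕ) (pp : PrimePower q) → 1 ≤ k → 3 ≤ t → suc m ≡ suc k * t →
    (K : Field c₁ ℓ₁) → HasOrder K q →
    (L : Field c₂ ℓ₂) → HasOrder L (q ^ suc m) →
    (E : Extension K L) →
    (α : Field.Carrier L) → IsGenerator L α →
    let open Linear K (Extension.vectorSpace E)
        Hyp = Hyperplane m (c₁ ⊔ c₂ ⊔ ℓ₂)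
    in
    Σ[ N ∈ ℕ ] Σ[ I ∈ (Fin N → Fin (t ∸ 1) → Fin (β pp k m)) ]
    let W : Fin N → Subspace (c₁ ⊔ c₂ ⊔ ℓ₂)
        W j = Span (⋃ (Fin (t ∸ 1)) (λ s → S pp k m L α (I j s)))
    in
      (∀ j → Injective _≡_ _≡_ (I j))
    × (∀ j → HasProjectiveDimension (W j) (m ∸ k ∸ 1))
    × (∀ i j → i ≢ j → ¬ (Σ[ H ∈ Hyp ] (W i ⊑ proj₁ H × W j ⊑ proj₁ H)))
    × (∀ (H : Hyp) → ∃[ j ] W j ⊑ proj₁ H)
    × IsPartition (λ j (H : Hyp) → W j ⊑ proj₁ H)
theorem18 {c₁} {_} {c₂} {ℓ₂} q k t m pp@(r , e , r-prime , q≡r^[1+e]) 1≤k 3≤t 1+m≡[1+k]t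
          K |K|≡q L |L|≡n E α α-generates =
  N , (λ j → I (g j)) , (λ j → I-injective (g j)) , (λ j → W-dimension (g j)) , disjoint , cover ,
  record
    { nonempty = λ j → g j , W⊑ (g j)
    ; disjoint = λ i j i≢j (H , Wᵢ⊑H , Wⱼ⊑H) → disjoint i j i≢j (H , Wᵢ⊑H , Wⱼ⊑H)
    ; covering = cover
    }
  where
  module L = Field L
  module LP = FieldProperties L
  o b n M : ℕ
  o = q ^ suc k ∸ 1
  b = β pp k m
  n = q ^ suc m
  -- The vector space dimension of a hyperplane as `Hyperplane` spells it; it equals m because 1 ≤
  -- m.
  M = suc (m ∸ 1)

  instance
    o-nonZero : NonZero o
    o-nonZero = qⁿ⁺¹∸1-nonZero pp k
    q-nonZero : NonZero q
    q-nonZero = ℕ.>-nonZero (ℕ.<⇒≤ (primePower>1 pp))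

  1+o≡q^[1+k] : suc o ≡ q ^ suc k
  1+o≡q^[1+k] = ℕ.m+[n∸m]≡n (ℕ.m^n>0 q (suc k))

  [1+o]^i≡q^[[1+k]i] : ∀ i → suc o ^ i ≡ q ^ (suc k * i)
  [1+o]^i≡q^[[1+k]i] i = trans (cong (_^ i) 1+o≡q^[1+k]) (ℕ.^-*-assoc q (suc k) i)

  [1+o]^t≡n : suc o ^ t ≡ n
  [1+o]^t≡n = trans ([1+o]^i≡q^[[1+k]i] t) (cong (q ^_) (sym 1+m≡[1+k]t))

  b*o≡n∸1 : b * o ≡ n ∸ 1
  b*o≡n∸1 = m/n*n≡m (subst (λ i → o ∣ i ∸ 1) [1+o]^t≡n (o∣[1+o]^t∸1 o t))

  -- Both the order of L and 1 + o are powers of the prime r below q; the former shows that r is the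
  -- characteristic.
  additive : AdditivePower L (suc o)
  additive = subst (AdditivePower L) (sym (trans 1+o≡q^[1+k] (q^i≡r^ (suc k))))
    (LP.frobenius-iterated r-prime r1≈0 (suc e * suc k))
    where
    open Mult L.semiring using () renaming (_×_ to _∙_)
    q^i≡r^ : ∀ i → q ^ i ≡ r ^ (suc e * i)
    q^i≡r^ i = trans (cong (_^ i) q≡r^[1+e]) (ℕ.^-*-assoc r (suc e) i)
    r1≈0 : r ∙ L.1# L.≈ L.0#
    r1≈0 = FiniteField.[r^m]∙1≈0⇒r∙1≈0 L |L|≡n r (suc e * suc m)
      (subst (λ i → i ∙ L.1# L.≈ L.0#) (q^i≡r^ (suc m)) (FiniteField.order∙1≈0 L |L|≡n))

  open Extension E using (embed; isRingHomomorphism; vectorSpace)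

  -- a^q = a holds in K; iterating it k + 1 times gives the exponent q^(k+1) = 1 + o.
  K-fixed : ∀ a → FixedBy L (suc o) (embed a)
  K-fixed a = subst (λ i → FixedBy L i (embed a)) (sym 1+o≡q^[1+k]) (fixed-by-q^ (suc k))
    where
    open IsRingHomomorphism isRingHomomorphism
    embed-^ : ∀ i → embed a L.^ᶠ i L.≈ embed (Field._^ᶠ_ K a i)
    embed-^ zero = L.sym 1#-homo
    embed-^ (suc i) = L.trans (L.*-congˡ (embed-^ i)) (L.sym (*-homo a _))
    fixed-by-q^ : ∀ i → FixedBy L (q ^ i) (embed a)
    fixed-by-q^ zero = L.*-identityʳ _
    fixed-by-q^ (suc i) = L.trans (L.sym (LP.^-assocʳ (embed a) q (q ^ i))) (L.trans
      (LP.^-congˡ (q ^ i) (L.trans (embed-^ q) (⟦⟧-cong (FiniteField.x^order≈x K |K|≡q a))))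
      (fixed-by-q^ i))

  open Tower K |K|≡q L |L|≡n E α α-generates o b b*o≡n∸1 additive K-fixed
  open LK using (Subspace; ⟨_⟩; _⊑_; Span; LinearlyIndependent)

  Hyp : Set _
  Hyp = LK.Hyperplane m (c₁ ⊔ c₂ ⊔ ℓ₂)

  1≤m : 1 ≤ m
  1≤m = ℕ.≤-trans 1≤k (ℕ.≤-pred (subst (suc k ≤_) (sym 1+m≡[1+k]t)
    (ℕ.m≤m*n (suc k) t {{ℕ.>-nonZero (ℕ.≤-trans (s≤s z≤n) 3≤t)}})))

  q^[1+M]≡n : q ^ suc M ≡ n
  q^[1+M]≡n = cong (λ i → q ^ suc i) (ℕ.m+[n∸m]≡n 1≤m)

  Core : Hyp → LF.Subspace _
  Core (H , _) = core H

  core-basis : ∀ H → LF.HasDimension (Core H) (t ∸ 1)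
  core-basis (H , H-dimension) = Hyperplanes.core-dimension q^[1+M]≡n H H-dimension {t} [1+o]^t≡n

  module Chosen (H : Hyp) = CosetBasis {W = Core H} (proj₂ (core-basis H))

  I : Hyp → Fin (t ∸ 1) → Fin b
  I H = Chosen.cosetIndex H

  I-injective : ∀ H → Injective _≡_ _≡_ (I H)
  I-injective H = Chosen.cosetIndex-injective H

  W : Hyp → Subspace (c₁ ⊔ c₂ ⊔ ℓ₂)
  W H = Chosen.CosetSpan H

  W⊑ : ∀ H → W H ⊑ proj₁ H
  W⊑ H x∈ = core⊆ (proj₁ H) (Chosen.cosetSpan⊆ H x∈)

  W-dimension : ∀ H → LK.HasProjectiveDimension (W H) (m ∸ k ∸ 1)
  W-dimension H = Chosen.cosetSpan-dimension H (suc (m ∸ k ∸ 1))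
    (trans (cong (q ^_) exponent) (sym ([1+o]^i≡q^[[1+k]i] (t ∸ 1))))
    where
    m∸k≡[1+k][t∸1] : m ∸ k ≡ suc k * (t ∸ 1)
    m∸k≡[1+k][t∸1] = trans (cong (_∸ suc k) 1+m≡[1+k]t)
      (sym (trans (ℕ.*-distribˡ-∸ (suc k) t 1) (cong (suc k * t ∸_) (ℕ.*-identityʳ (suc k)))))
    -- The product is positive since t exceeds 1, so the truncated subtraction of 1 is undone by
    -- `suc`.
    exponent : suc (m ∸ k ∸ 1) ≡ suc k * (t ∸ 1)
    exponent = trans (ℕ.m+[n∸m]≡n (subst (1 ≤_) (sym m∸k≡[1+k][t∸1])
      (ℕ.*-mono-≤ (s≤s {n = k} z≤n) (ℕ.m<n⇒0<n∸m (ℕ.≤-trans (s≤s (s≤s z≤n)) 3≤t))))) m∸k≡[1+k][t∸1]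

  -- All cores have the same size, so this inclusion already amounts to equality of the two cores,
  -- hence its symmetry.
  Core⊆ : Hyp → Hyp → Set _
  Core⊆ H H′ = ∀ x → LF.⟨ Core H ⟩ x → ⟨ proj₁ H′ ⟩ x

  core-reverse : ∀ {H H′} → Core⊆ H H′ → ∀ {x} → LF.⟨ Core H′ ⟩ x → LF.⟨ Core H ⟩ x
  core-reverse {H} {H′} core⊆H′ =
    core-⊆⇒⊇ (proj₁ H) (proj₁ H′) (core-basis H) (core-basis H′) (core⊆H′ _)

  Core⊆-sym : Symmetric Core⊆
  Core⊆-sym {H} {H′} core⊆H′ x x∈ = core⊆ (proj₁ H) (core-reverse {H} {H′} core⊆H′ x∈)

  Core⊆? : Decidable Core⊆
  Core⊆? (H , H-dim) (H′ , H′-dim) = Finite.all? |L|≡n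
    (λ x≈y x∈⇒ y∈ → Subspace.resp-≈ H′ x≈y (x∈⇒ (LF.Subspace.resp-≈ (core H) (L.sym x≈y) y∈)))
    (λ x → core? H (SK.finiteDimensional⇒decidable {W = H} H-dim) x
           →-dec SK.finiteDimensional⇒decidable {W = H′} H′-dim x)

  Range : ∀ {d} → Vector L.Carrier d → Pred L.Carrier ℓ₂
  Range h x = ∃[ i ] x L.≈ h i

  -- The span of a tuple lies at the universe level of `Hyp`, so a tuple that passes the
  -- independence test yields a hyperplane to choose from.
  range-hyperplane : (h : Vector L.Carrier M) → LinearlyIndependent h → Hyp
  range-hyperplane h independent = Span (Range h) , h , record
    { members = λ i → LK.inject (i , L.refl)
    ; independent = independent
    ; spanning = span⊆ (SK.Combinations h) (λ (i , x≈hᵢ) → SK.δ i , L.trans x≈hᵢ (L.sym (SK.combination-δ h i)))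
    }

  tuple : Fin (n ^ M) → Vector L.Carrier M
  tuple c i = Finite.enumeration |L|≡n .Enumeration.enum (Fin.finToFun c i)

  abstract
    representatives : Σ[ N ∈ ℕ ] Σ[ g ∈ (Fin N → Hyp) ] (∀ i j → i ≢ j → ¬ Core⊆ (g i) (g j)) ×
      (∀ c → LinearlyIndependent (tuple c) → Σ[ p ∈ LinearlyIndependent (tuple c) ]
        ∃[ j ] Core⊆ (g j) (range-hyperplane (tuple c) p))
    representatives = transversal Core⊆ (λ {H} x → core⊆ (proj₁ H)) (λ {H} {H′} → Core⊆-sym {H} {H′}) Core⊆?
      (λ c → SK.linearlyIndependent? (tuple c)) (λ c → range-hyperplane (tuple c))

  N : ℕ
  N = proj₁ representatives

  g : Fin N → Hyp
  g = proj₁ (proj₂ representatives)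

  -- Both cores lie in H, hence both coincide with core H, but distinct representatives have
  -- different cores.
  disjoint : ∀ i j → i ≢ j → ¬ (Σ[ H ∈ Hyp ] (W (g i) ⊑ proj₁ H × W (g j) ⊑ proj₁ H))
  disjoint i j i≢j (H , Wᵢ⊑H , Wⱼ⊑H) = proj₁ (proj₂ (proj₂ representatives)) i j i≢j
    (λ x x∈ → core⊆ (proj₁ (g j)) (core-H⊆ j Wⱼ⊑H (core-reverse {H} {g i}
      (λ y y∈ → core⊆ (proj₁ (g i)) (core-H⊆ i Wᵢ⊑H y∈)) x∈)))
    where
    core-H⊆ : ∀ i → W (g i) ⊑ proj₁ H → ∀ {x} → LF.⟨ Core H ⟩ x → LF.⟨ Core (g i) ⟩ x
    core-H⊆ i Wᵢ⊑H = core-reverse {g i} {H} (λ x x∈ → Wᵢ⊑H (Chosen.⊆cosetSpan (g i) x∈))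

  cover : ∀ (H : Hyp) → ∃[ j ] W (g j) ⊑ proj₁ H
  -- The listed tuple agrees with h only up to `_≈_`, so the core found for it reaches H through the
  -- span of that tuple.
  cover (H , h , h-isBasis) = j , λ x∈ → span⊆ H
    (λ (i , x≈) → Subspace.resp-≈ H (L.sym (L.trans x≈ (tuple-i₀≈h i))) (members i))
    (core⊆H _ (Chosen.cosetSpan⊆ (g j) x∈))
    where
    open LK.IsBasis h-isBasis using (members; independent)
    open Enumeration (Finite.enumeration |L|≡n) using (enum; index; enum-index)
    i₀ : Fin (n ^ M)
    i₀ = Fin.funToFin (λ i → index {h i} _)
    tuple-i₀≈h : ∀ i → tuple i₀ i L.≈ h i
    tuple-i₀≈h i = L.trans
      (L.reflexive (cong enum (Fin.finToFun-funToFin (λ i → index {h i} _) i))) (enum-index _)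
    represented : Σ[ p ∈ LinearlyIndependent (tuple i₀) ] ∃[ j ] Core⊆ (g j) (range-hyperplane (tuple i₀) p)
    represented = proj₂ (proj₂ (proj₂ representatives)) i₀
      (SK.linearlyIndependent-resp (λ i → L.sym (tuple-i₀≈h i)) independent)
    j : Fin N
    j = proj₁ (proj₂ represented)
    core⊆H : Core⊆ (g j) (range-hyperplane (tuple i₀) (proj₁ represented))
    core⊆H = proj₂ (proj₂ represented)
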